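{- Let $\mathcal{T}_1$ and $\mathcal{T}_2$ be trees, and let $G$ be a graph formed from the disjoint union of $\mathcal{T}_1$ and $\mathcal{T}_2$ by adding an edge $v_1\sim v_2$, where $v_1\in V(\mathcal{T}_1)$ and $v_2\in V(\mathcal{T}_2)$. Then $\kappa(G)$ is minimized (over all choices of $v_1\in V(\mathcal{T}_1)$ and $v_2\in V(\mathcal{T}_2)$) if and only if $v_1$ and $v_2$ are centroids of $\mathcal{T}_1$ and $\mathcal{T}_2$, respectively.
   Context: All graphs are finite, simple and undirected. For a connected graph $H$ with $m_H$ edges, Kemeny's constant is that of the simple random walk on $H$ (from a vertex, move to a uniformly random neighbour): $\kappa(H)=\sum_{j\neq i}\pi_jm_{i,j}$, where $\pi_j=\deg_H(j)/(2m_H)$ is the stationary distribution and $m_{i,j}$ is the mean first passage time from $i$ to $j$; it does not depend on the choice of the vertex $i$. A vertex $v$ of a tree $\mathcal{T}$ on $n$ vertices is a centroid if each connected component of $\mathcal{T}-v$ contains at most $\lfloor n/2\rfloor$ vertices. -}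

module Defs where

open import Data.Bool.Base using (Bool; false; T; if_then_else_; _∧_)
open import Data.Fin.Base using (Fin; zero; suc; toℕ; fromℕ; inject₁; splitAt)
open import Data.Fin.Properties using (_≟_; _<?_)
open import Data.Fin.Subset using (Subset; _∈_) renaming (∣_∣ to card)
open import Data.Integer.Base using (+_)
open import Data.Nat.Base as ℕ using (ℕ; zero; suc; NonZero; ⌊_/2⌋)
import Data.Nat.Properties as ℕₚ
open import Data.Product.Base using (∃; _×_)
open import Data.Rational.Base using (ℚ; 0ℚ; 1ℚ; _/_; _*_; _-_; _<_; ∣_∣)
import Data.Rational.Properties as ℚₚ
open import Data.Sum.Base using (_⊎_; inj₁; inj₂)
open import Data.Vec.Base using (tabulate)
open import Function.Bundles using (_⇔_)
open import Function.Definitions using (Injective)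
open import Relation.Binary.Construct.Closure.ReflexiveTransitive using (Star)
open import Relation.Binary.PropositionalEquality.Core using (_≡_; _≢_; refl)
open import Relation.Nullary.Decidable.Core using (⌊_⌋)
open import Relation.Nullary.Negation.Core using (¬_)

import Algebra.Properties.CommutativeMonoid.Sum ℕₚ.+-0-commutativeMonoid as Sumℕ
import Algebra.Properties.CommutativeMonoid.Sum ℚₚ.+-0-commutativeMonoid as Sumℚ

------------------------------------------------------------------------
-- Graphs and trees

record Graph (n : ℕ) : Set where
  field
    adj      : Fin n → Fin n → Bool
    symm     : ∀ x y → adj x y ≡ adj y x
    loopless : ∀ x → adj x x ≡ false

  Adj : Fin n → Fin n → Set
  Adj x y = T (adj x y)

open Graph public

module _ {n : ℕ} (H : Graph n) where

  deg : Fin n → ℕ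
  deg x = card (tabulate (adj H x))

  -- Each edge {x , y} is counted once, with x < y.
  edgeCount : ℕ
  edgeCount = Sumℕ.sum λ x → card (tabulate λ y → ⌊ x <? y ⌋ ∧ adj H x y)

  Connected : Set
  Connected = NonZero n × (∀ x y → Star (Adj H) x y)

  -- A cycle visits 3 + k distinct vertices in turn and closes up.
  Acyclic : Set
  Acyclic = ¬ (∃ λ k → ∃ λ (c : Fin (3 ℕ.+ k) → Fin n) →
    Injective _≡_ _≡_ c
    × (∀ i → Adj H (c (inject₁ i)) (c (suc i)))
    × Adj H (c (fromℕ (2 ℕ.+ k))) (c zero))

  IsTree : Set
  IsTree = Connected × Acyclic

  -- Adjacency in the graph H - v; the vertices of H - v are those x ≢ v.
  AdjWithout : Fin n → Fin n → Fin n → Set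
  AdjWithout v x y = x ≢ v × y ≢ v × Adj H x y

  IsComponentWithout : Fin n → Subset n → Set
  IsComponentWithout v S =
    ∃ λ u → u ≢ v × (∀ x → x ∈ S ⇔ Star (AdjWithout v) u x)

  IsCentroid : Fin n → Set
  IsCentroid v = ∀ S → IsComponentWithout v S → card S ℕ.≤ ⌊ n /2⌋

-- The disjoint union of H₁ and H₂ together with the edge v₁ ∼ v₂.  The
-- vertices of H₁ are the first n₁ elements of Fin (n₁ + n₂).
module _ {n₁ n₂ : ℕ} (H₁ : Graph n₁) (H₂ : Graph n₂) (v₁ : Fin n₁) (v₂ : Fin n₂) where

  joinAdj : Fin n₁ ⊎ Fin n₂ → Fin n₁ ⊎ Fin n₂ → Bool
  joinAdj (inj₁ x) (inj₁ y) = adj H₁ x y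
  joinAdj (inj₂ x) (inj₂ y) = adj H₂ x y
  joinAdj (inj₁ x) (inj₂ y) = ⌊ x ≟ v₁ ⌋ ∧ ⌊ y ≟ v₂ ⌋
  joinAdj (inj₂ x) (inj₁ y) = ⌊ y ≟ v₁ ⌋ ∧ ⌊ x ≟ v₂ ⌋

  joinAdj-symm : ∀ a b → joinAdj a b ≡ joinAdj b a
  joinAdj-symm (inj₁ x) (inj₁ y) = symm H₁ x y
  joinAdj-symm (inj₁ x) (inj₂ y) = refl
  joinAdj-symm (inj₂ x) (inj₁ y) = refl
  joinAdj-symm (inj₂ x) (inj₂ y) = symm H₂ x y

  joinAdj-loopless : ∀ a → joinAdj a a ≡ false
  joinAdj-loopless (inj₁ x) = loopless H₁ x
  joinAdj-loopless (inj₂ x) = loopless H₂ x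

  joinByEdge : Graph (n₁ ℕ.+ n₂)
  joinByEdge = record
    { adj      = λ x y → joinAdj (splitAt n₁ x) (splitAt n₁ y)
    ; symm     = λ x y → joinAdj-symm (splitAt n₁ x) (splitAt n₁ y)
    ; loopless = λ x → joinAdj-loopless (splitAt n₁ x)
    }

------------------------------------------------------------------------
-- Random walks and Kemeny's constant

-- The quotient a / b, with the junk value 0 for b = 0.
ratio : ℕ → ℕ → ℚ
ratio a zero    = 0ℚ
ratio a (suc b) = + a / suc b

sumExcept : ∀ {n} → Fin n → (Fin n → ℚ) → ℚ
sumExcept i f = Sumℚ.sum λ k → if ⌊ k ≟ i ⌋ then 0ℚ else f k

_⟶_ : (ℕ → ℚ) → ℚ → Set
s ⟶ l = ∀ ε → 0ℚ < ε → ∃ λ N → ∀ n → N ℕ.≤ n → ∣ s n - l ∣ < ε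

-- The series a 0 + a 1 + a 2 + ⋯ converges to l.
_HasSum_ : (ℕ → ℚ) → ℚ → Set
a HasSum l = (λ N → Sumℚ.sum {N} λ t → a (toℕ t)) ⟶ l

module _ {n : ℕ} (H : Graph n) where

  transition : Fin n → Fin n → ℚ
  transition i j = if adj H i j then ratio 1 (deg H i) else 0ℚ

  stationary : Fin n → ℚ
  stationary j = ratio (deg H j) (2 ℕ.* edgeCount H)

  -- firstPassage j t i is the probability that the walk started at i
  -- visits j at time t and at none of the times 1, …, t - 1.
  firstPassage : Fin n → ℕ → Fin n → ℚ
  firstPassage j zero          i = 0ℚ
  firstPassage j (suc zero)    i = transition i j
  firstPassage j (suc (suc t)) i =
    sumExcept j λ k → transition i k * firstPassage j (suc t) k

  -- m is the expectation of the first passage time from i to j.  The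
  -- first condition says that this time is almost surely finite.
  IsMeanFirstPassageTime : Fin n → Fin n → ℚ → Set
  IsMeanFirstPassageTime i j m =
    (λ t → firstPassage j t i) HasSum 1ℚ
    × (λ t → (+ t / 1) * firstPassage j t i) HasSum m

  -- The value Σ_{j ≠ i} π_j m_{i,j} is required to be κ for every
  -- starting vertex i.  As limits are unique, at most one κ qualifies
  -- when n is nonzero.
  IsKemenyConstant : ℚ → Set
  IsKemenyConstant κ = ∀ i → ∃ λ (m : Fin n → ℚ) →
    (∀ j → j ≢ i → IsMeanFirstPassageTime i j (m j))
    × κ ≡ sumExcept i λ j → stationary j * m j

-- Let r be the distance of a tree, d the degree, M = Σ d and D i = Σ_k d k · r i k.
-- Every neighbour of i is one step further from j than i is, except for a
-- single neighbour that is one step closer (if i ≢ j); hence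
-- h i = ½ (M · r i j + D j - D i) solves the first-step equations
-- h i = 1 + Σ_{k ≢ j} p i k · h k.  A nonnegative solution of these equations is
-- the mean first passage time: if Q is the transition matrix killed at j, then
-- Qᵗh is the expected remaining time Σ_{s ≥ t} Qˢ1, and h ≤ B · 1 makes it decay.
-- Summing over j with the stationary weights, the terms in D i cancel and
-- κ = (1 / 2M) Σ_{i,j} d i · d j · r i j, whatever the starting vertex.
--
-- For the joined tree this is α + β · W₁ v₁ + γ · W₂ v₂ with β, γ > 0 and
-- W v = Σ_x r v x, because Σ_k d k · r v k = 2 W v - M / 2.  So v₁ and v₂ have to
-- minimise W₁ and W₂ separately.  Minimisers of W are the centroids: passing
-- from v to a neighbour in a branch S at v changes W by n - 2 |S|, and passing
-- to a vertex w of S changes W by at least r v w · (n - 2 |S|).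
module Submission where

open import Defs
open import Algebra.Bundles using (CommutativeRing)
open import Data.Bool.Base using (Bool; true; false; T; if_then_else_; _∧_)
import Data.Bool.Properties as Boolₚ
open import Data.Fin.Base using (Fin; zero; suc; toℕ; fromℕ; inject₁; splitAt)
import Data.Fin.Base as Fin
open import Data.Fin.Properties using (_≟_; _<?_)
import Data.Fin.Properties as Finₚ
open import Data.Fin.Subset using (Subset; _∈_) renaming (∣_∣ to card)
import Data.Fin.Subset.Properties as Subsetₚ
open import Data.Integer.Base as ℤ using (+_)
import Data.Integer.Properties as ℤₚ
open import Data.Nat.Base as ℕ using (ℕ; zero; suc; ⌊_/2⌋)
import Data.Nat.Induction as ℕᵢ
import Data.Nat.Properties as ℕₚ
open import Data.Nat.Tactic.RingSolver using () renaming (solve-∀ to ℕ-solve-∀)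
open import Data.Product.Base using (∃; _×_; _,_; proj₁; proj₂)
open import Data.Rational.Base
  using (ℚ; 0ℚ; 1ℚ; ½; _/_; _+_; _*_; _-_; -_; _≤_; _<_; ∣_∣; *≤*; toℚᵘ; 1/_; nonNegative;
    positive; mkℚ)
import Data.Rational.Properties as ℚₚ
open import Data.Rational.Unnormalised.Base as ℚᵘ using (mkℚᵘ; *≡*)
import Data.Rational.Unnormalised.Properties as ℚᵘₚ
open import Data.Sum.Base as Sum using (_⊎_; inj₁; inj₂)
open import Data.Vec.Base using (tabulate)
open import Data.Vec.Properties using (lookup∘tabulate; []=⇒lookup; lookup⇒[]=)
open import Function.Base using (_∘_; id)
open import Function.Bundles using (_⇔_; mk⇔; Equivalence)
open import Function.Definitions using (Injective)
open import Induction.WellFounded using (Acc; acc)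
open import Relation.Binary.Construct.Closure.ReflexiveTransitive using (Star; ε; _◅_)
open import Relation.Binary.PropositionalEquality
open import Relation.Nullary.Decidable using (⌊_⌋; dec⇒maybe; yes; no)
open import Relation.Nullary.Negation using (¬_; contradiction)
open import Tactic.RingSolver using (solve-∀)
open import Tactic.RingSolver.Core.AlmostCommutativeRing
  using (AlmostCommutativeRing; fromCommutativeRing)

import Algebra.Properties.CommutativeMonoid.Sum ℕₚ.+-0-commutativeMonoid as Sumℕ
import Algebra.Properties.CommutativeMonoid.Sum ℚₚ.+-0-commutativeMonoid as Sumℚ
import Algebra.Properties.Semiring.Sum (CommutativeRing.semiring ℚₚ.+-*-commutativeRing) as SemiringSumℚ

-- ℚ is not complete, so both series are summed by exhibiting the limit together with a rate: the
-- closed form `h` is the candidate, and each tail is bounded by C / N. With u = Qᵗh and s = Qᵗ1 the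
-- rate comes from a potential (t + 2B)² u that never increases, a polynomial inequality that avoids
-- powers of 1 - 1/B. The joined graph is never shown to be a tree. What hitting times use is
-- isolated in `TreeMetric`: a metric with one linear identity for the distances of neighbours. Each
-- given tree satisfies it, and it passes to the join by gluing the two metrics along the new edge,
-- where each end merely gains a neighbour. Acyclicity enters through one fact: a non-backtracking
-- walk of positive length is never closed. Distances can then be lengths of such walks, with no
-- minimum taken. The relation between Σ_k d k · r v k and W v comes from squared distances, because
-- (r + 1)² - (r - 1)² = 4 r is linear in r.

ℚ-ring : AlmostCommutativeRing _ _
ℚ-ring = fromCommutativeRing ℚₚ.+-*-commutativeRing (λ x → dec⇒maybe (0ℚ ℚₚ.≟ x))

-- Order arithmetic in ℚ.

p≤q⇒0≤q-p : ∀ {p q} → p ≤ q → 0ℚ ≤ q - p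
p≤q⇒0≤q-p {p} {q} p≤q = subst (_≤ q - p) (ℚₚ.+-inverseʳ p) (ℚₚ.+-monoˡ-≤ (- p) p≤q)

0≤q-p⇒p≤q : ∀ {p q} → 0ℚ ≤ q - p → p ≤ q
0≤q-p⇒p≤q {p} {q} 0≤q-p = subst₂ _≤_ (ℚₚ.+-identityˡ p) (lemma q p) (ℚₚ.+-monoˡ-≤ p 0≤q-p)
  where
  lemma : ∀ q p → q - p + p ≡ q
  lemma = solve-∀ ℚ-ring

0≤p+q : ∀ {p q} → 0ℚ ≤ p → 0ℚ ≤ q → 0ℚ ≤ p + q
0≤p+q {p} {q} 0≤p 0≤q = ℚₚ.+-mono-≤ {0ℚ} {p} {0ℚ} {q} 0≤p 0≤q

*-monoˡ-≤ : ∀ {r p q} → 0ℚ ≤ r → p ≤ q → r * p ≤ r * q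
*-monoˡ-≤ {r} 0≤r = ℚₚ.*-monoˡ-≤-nonNeg r {{nonNegative 0≤r}}

0≤p*q : ∀ {p q} → 0ℚ ≤ p → 0ℚ ≤ q → 0ℚ ≤ p * q
0≤p*q {p} {q} 0≤p 0≤q = subst (_≤ p * q) (ℚₚ.*-zeroʳ p) (*-monoˡ-≤ 0≤p 0≤q)

0<1 : 0ℚ < 1ℚ
0<1 = ℚₚ.positive⁻¹ 1ℚ

0<p+q : ∀ {p q} → 0ℚ ≤ p → 0ℚ < q → 0ℚ < p + q
0<p+q {p} {q} 0≤p 0<q = ℚₚ.+-mono-≤-< {0ℚ} {p} {0ℚ} {q} 0≤p 0<q

0<p*q : ∀ {p q} → 0ℚ < p → 0ℚ < q → 0ℚ < p * q
0<p*q {p} {q} 0<p 0<q = ℚₚ.positive⁻¹ (p * q) {{ℚₚ.pos*pos⇒pos p {{positive 0<p}} q {{positive 0<q}}}}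

*-cancelˡ-≤ : ∀ {c p q} → 0ℚ < c → c * p ≤ c * q → p ≤ q
*-cancelˡ-≤ {c} 0<c = ℚₚ.*-cancelˡ-≤-pos c {{positive 0<c}}

-- The embedding of ℕ into ℚ

opaque
  -- Opaque, so that `ι n` stays an atom in conversion checking and does not unfold into the gcd
  -- normalisation behind `+ n / 1`.
  ι : ℕ → ℚ
  ι n = + n / 1

  ι-def : ∀ n → ι n ≡ + n / 1
  ι-def n = refl

ι-0 : ι 0 ≡ 0ℚ
ι-0 = ι-def 0

ι-1 : ι 1 ≡ 1ℚ
ι-1 = ι-def 1

toℚᵘ-ι : ∀ n → toℚᵘ (ι n) ℚᵘ.≃ mkℚᵘ (+ n) 0
toℚᵘ-ι n = subst (λ q → toℚᵘ q ℚᵘ.≃ mkℚᵘ (+ n) 0) (sym (ι-def n)) (ℚₚ.toℚᵘ-fromℚᵘ (mkℚᵘ (+ n) 0))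

ι-+ : ∀ m n → ι (m ℕ.+ n) ≡ ι m + ι n
ι-+ m n = ℚₚ.toℚᵘ-injective (begin
  toℚᵘ (ι (m ℕ.+ n))             ≈⟨ toℚᵘ-ι (m ℕ.+ n) ⟩
  mkℚᵘ (+ (m ℕ.+ n)) 0           ≈⟨ *≡* (cong (ℤ._* + 1) (sym (cong₂ ℤ._+_ (ℤₚ.*-identityʳ (+ m)) (ℤₚ.*-identityʳ (+ n))))) ⟩
  mkℚᵘ (+ m) 0 ℚᵘ.+ mkℚᵘ (+ n) 0 ≈⟨ ℚᵘₚ.+-cong (toℚᵘ-ι m) (toℚᵘ-ι n) ⟨
  toℚᵘ (ι m) ℚᵘ.+ toℚᵘ (ι n)     ≈⟨ ℚₚ.toℚᵘ-homo-+ (ι m) (ι n) ⟨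
  toℚᵘ (ι m + ι n)               ∎)
  where open ℚᵘₚ.≃-Reasoning

ι-suc : ∀ n → ι (suc n) ≡ 1ℚ + ι n
ι-suc n = trans (ι-+ 1 n) (cong (λ z → z + ι n) ι-1)

0≤ι : ∀ n → 0ℚ ≤ ι n
0≤ι n = subst (0ℚ ≤_) (sym (ι-def n)) (ℚₚ.nonNegative⁻¹ (+ n / 1) {{ℚₚ.normalize-nonNeg n 1}})

ι-mono-≤ : ∀ {m n} → m ℕ.≤ n → ι m ≤ ι n
ι-mono-≤ {m} {n} m≤n = subst₂ _≤_ (ℚₚ.+-identityʳ (ι m))
  (trans (sym (ι-+ m (n ℕ.∸ m))) (cong ι (ℕₚ.m+[n∸m]≡n m≤n)))
  (ℚₚ.+-monoʳ-≤ (ι m) (0≤ι (n ℕ.∸ m)))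

0<ι-suc : ∀ n → 0ℚ < ι (suc n)
0<ι-suc n = subst (0ℚ <_) (sym (ι-def (suc n))) (ℚₚ.positive⁻¹ (+ suc n / 1) {{ℚₚ.normalize-pos (suc n) 1}})

ι-mono-< : ∀ {m n} → m ℕ.< n → ι m < ι n
ι-mono-< {m} m<n = ℚₚ.<-≤-trans
  (subst₂ _<_ (ℚₚ.+-identityˡ (ι m)) (sym (ι-suc m)) (ℚₚ.+-monoˡ-< (ι m) (subst (0ℚ <_) ι-1 (0<ι-suc 0))))
  (ι-mono-≤ m<n)

ι-cancel-≤ : ∀ {m n} → ι m ≤ ι n → m ℕ.≤ n
ι-cancel-≤ {m} {n} ιm≤ιn with m ℕₚ.≤? n
... | yes m≤n = m≤n
... | no  m≰n = contradiction (ℚₚ.<-≤-trans (ι-mono-< (ℕₚ.≰⇒> m≰n)) ιm≤ιn) (ℚₚ.<-irrefl refl)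

ι-injective : ∀ {m n} → ι m ≡ ι n → m ≡ n
ι-injective eq = ℕₚ.≤-antisym (ι-cancel-≤ (ℚₚ.≤-reflexive eq)) (ι-cancel-≤ (ℚₚ.≤-reflexive (sym eq)))

ratio-*-ι : ∀ a {b} → b ≢ 0 → ratio a b * ι b ≡ ι a
ratio-*-ι a {zero}  b≢0 = contradiction refl b≢0
ratio-*-ι a {suc b} _   = ℚₚ.toℚᵘ-injective (begin
  toℚᵘ (ratio a (suc b) * ι (suc b))         ≈⟨ ℚₚ.toℚᵘ-homo-* (ratio a (suc b)) (ι (suc b)) ⟩
  toℚᵘ (ratio a (suc b)) ℚᵘ.* toℚᵘ (ι (suc b)) ≈⟨ ℚᵘₚ.*-cong (ℚₚ.toℚᵘ-fromℚᵘ (mkℚᵘ (+ a) b)) (toℚᵘ-ι (suc b)) ⟩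
  mkℚᵘ (+ a) b ℚᵘ.* mkℚᵘ (+ suc b) 0         ≈⟨ *≡* (ℤₚ.*-assoc (+ a) (+ suc b) (+ 1)) ⟩
  mkℚᵘ (+ a) 0                               ≈⟨ toℚᵘ-ι a ⟨
  toℚᵘ (ι a)                                 ∎)
  where open ℚᵘₚ.≃-Reasoning

open ≡-Reasoning

0≤ratio : ∀ a b → 0ℚ ≤ ratio a b
0≤ratio a zero    = ℚₚ.≤-refl
0≤ratio a (suc b) = ℚₚ.nonNegative⁻¹ (ratio a (suc b)) {{ℚₚ.normalize-nonNeg a (suc b)}}

0<ratio : ∀ a b → 0ℚ < ratio (suc a) (suc b)
0<ratio a b = ℚₚ.positive⁻¹ (ratio (suc a) (suc b)) {{ℚₚ.normalize-pos (suc a) (suc b)}}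

-- A denominator is at least 1, so a nonnegative numerator already bounds the fraction.
≤-ceiling : ∀ p → ∃ λ n → p ≤ ι n
≤-ceiling p@(mkℚ (+ n) d-1 _) = n , ℚₚ.toℚᵘ-cancel-≤ (ℚᵘₚ.≤-trans
  (ℚᵘ.*≤* (ℤₚ.*-monoˡ-≤-nonNeg (+ n) (ℤ.+≤+ (ℕ.s≤s ℕ.z≤n))))
  (ℚᵘₚ.≤-reflexive (ℚᵘₚ.≃-sym (toℚᵘ-ι n))))
≤-ceiling p@(mkℚ ℤ.-[1+ n ] d-1 _) = 0 , subst (p ≤_) (sym ι-0) (*≤* ℤ.-≤+)

archimedean : ∀ {δ} → 0ℚ < δ → ∀ C → ∃ λ n → C < δ * ι n
archimedean {δ} 0<δ C = suc n , lemma
  where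
  instance
    δ-nonZero = ℚₚ.pos⇒nonZero δ {{positive 0<δ}}
    δ-pos     = positive 0<δ
  ceil = ≤-ceiling (C * 1/ δ)
  n = proj₁ ceil
  lemma : C < δ * ι (suc n)
  lemma = ℚₚ.≤-<-trans
    (subst (_≤ δ * ι n) assoc (*-monoˡ-≤ (ℚₚ.<⇒≤ 0<δ) (proj₂ ceil)))
    (ℚₚ.*-monoʳ-<-pos δ (ι-mono-< (ℕₚ.n<1+n n)))
    where
    rearrange : ∀ e c i → e * (c * i) ≡ c * (e * i)
    rearrange = solve-∀ ℚ-ring
    assoc : δ * (C * 1/ δ) ≡ C
    assoc = begin
      δ * (C * 1/ δ) ≡⟨ rearrange δ C _ ⟩
      C * (δ * 1/ δ) ≡⟨ cong (C *_) (ℚₚ.*-inverseʳ δ) ⟩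
      C * 1ℚ          ≡⟨ ℚₚ.*-identityʳ C ⟩
      C               ∎

-- Finite sums

∑ : ∀ {n} → (Fin n → ℚ) → ℚ
∑ = Sumℚ.sum

∑-cong : ∀ {n} {f g : Fin n → ℚ} → (∀ k → f k ≡ g k) → ∑ f ≡ ∑ g
∑-cong = Sumℚ.sum-cong-≗

∑-*ˡ : ∀ {n} c (f : Fin n → ℚ) → ∑ (λ k → c * f k) ≡ c * ∑ f
∑-*ˡ c f = sym (SemiringSumℚ.*-distribˡ-sum c f)

∑-*ʳ : ∀ {n} c (f : Fin n → ℚ) → ∑ (λ k → f k * c) ≡ ∑ f * c
∑-*ʳ c f = sym (SemiringSumℚ.*-distribʳ-sum c f)

∑-- : ∀ {n} (f g : Fin n → ℚ) → ∑ (λ k → f k - g k) ≡ ∑ f - ∑ g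
∑-- f g = begin
  ∑ (λ k → f k - g k)        ≡⟨ Sumℚ.∑-distrib-+ f (λ k → - g k) ⟩
  ∑ f + ∑ (λ k → - g k)      ≡⟨ cong (λ z → ∑ f + z) (∑-cong λ k → -‿*ˡ (g k)) ⟩
  ∑ f + ∑ (λ k → - 1ℚ * g k) ≡⟨ cong (λ z → ∑ f + z) (trans (∑-*ˡ (- 1ℚ) g) (sym (-‿*ˡ (∑ g)))) ⟩
  ∑ f - ∑ g                  ∎
  where
  -‿*ˡ : ∀ x → - x ≡ - 1ℚ * x
  -‿*ˡ = solve-∀ ℚ-ring

∑-mono : ∀ {n} {f g : Fin n → ℚ} → (∀ k → f k ≤ g k) → ∑ f ≤ ∑ g
∑-mono {zero}  f≤g = ℚₚ.≤-refl
∑-mono {suc n} f≤g = ℚₚ.+-mono-≤ (f≤g zero) (∑-mono (f≤g ∘ suc))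

0≤∑ : ∀ {n} {f : Fin n → ℚ} → (∀ k → 0ℚ ≤ f k) → 0ℚ ≤ ∑ f
0≤∑ {zero}  0≤f = ℚₚ.≤-refl
0≤∑ {suc n} 0≤f = ℚₚ.+-mono-≤ (0≤f zero) (0≤∑ (0≤f ∘ suc))

∑-zero : ∀ n → ∑ {n} (λ _ → 0ℚ) ≡ 0ℚ
∑-zero = Sumℚ.sum-replicate-zero

∑-splitAt : ∀ m {n} (f : Fin m ⊎ Fin n → ℚ) →
  ∑ (f ∘ splitAt m) ≡ ∑ (f ∘ inj₁) + ∑ (f ∘ inj₂)
∑-splitAt zero    f = sym (ℚₚ.+-identityˡ _)
∑-splitAt (suc m) f = begin
  f (inj₁ zero) + ∑ (f ∘ Sum.map suc id ∘ splitAt m)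
    ≡⟨ cong (λ z → f (inj₁ zero) + z) (∑-splitAt m (f ∘ Sum.map suc id)) ⟩
  f (inj₁ zero) + (∑ (f ∘ inj₁ ∘ suc) + ∑ (f ∘ inj₂))             ≡⟨ ℚₚ.+-assoc (f (inj₁ zero)) _ _ ⟨
  ∑ (f ∘ inj₁) + ∑ (f ∘ inj₂)                                     ∎

ι-∑ : ∀ {n} (f : Fin n → ℕ) → ι (Sumℕ.sum f) ≡ ∑ (ι ∘ f)
ι-∑ {zero}  f = ι-0
ι-∑ {suc n} f = trans (ι-+ (f zero) _) (cong (λ z → ι (f zero) + z) (ι-∑ (f ∘ suc)))

∑-const : ∀ n c → ∑ {n} (λ _ → c) ≡ ι n * c
∑-const zero    c = sym (trans (cong (_* c) ι-0) (ℚₚ.*-zeroˡ c))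
∑-const (suc n) c = trans (cong (λ z → c + z) (∑-const n c))
  (trans (lemma c (ι n)) (cong (_* c) (sym (ι-suc n))))
  where
  lemma : ∀ c m → c + m * c ≡ (1ℚ + m) * c
  lemma = solve-∀ ℚ-ring

-- Indicators and sums that omit one index.

𝟙 : Bool → ℚ
𝟙 b = if b then 1ℚ else 0ℚ

0≤𝟙 : ∀ b → 0ℚ ≤ 𝟙 b
0≤𝟙 true  = subst (0ℚ ≤_) ι-1 (0≤ι 1)
0≤𝟙 false = ℚₚ.≤-refl

if-then : ∀ b c → (if b then c else 0ℚ) ≡ 𝟙 b * c
if-then true  c = sym (ℚₚ.*-identityˡ c)
if-then false c = sym (ℚₚ.*-zeroˡ c)

ι-card : ∀ {n} (b : Fin n → Bool) → ι (card (tabulate b)) ≡ ∑ (𝟙 ∘ b)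
ι-card {zero}  b = ι-0
ι-card {suc n} b with b zero
... | true  = trans (ι-suc (card (tabulate (b ∘ suc)))) (cong (λ z → 1ℚ + z) (ι-card (b ∘ suc)))
... | false = trans (ι-card (b ∘ suc)) (sym (ℚₚ.+-identityˡ _))

⌊suc≟suc⌋ : ∀ {n} (k i : Fin n) → ⌊ suc k ≟ suc i ⌋ ≡ ⌊ k ≟ i ⌋
⌊suc≟suc⌋ k i with k ≟ i
... | yes _ = refl
... | no  _ = refl

⌊≟⌋-refl : ∀ {n} (i : Fin n) → ⌊ i ≟ i ⌋ ≡ true
⌊≟⌋-refl i with i ≟ i
... | yes _   = refl
... | no  i≢i = contradiction refl i≢i

⌊≟⌋-≢ : ∀ {n} {i j : Fin n} → i ≢ j → ⌊ i ≟ j ⌋ ≡ false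
⌊≟⌋-≢ {i = i} {j} i≢j with i ≟ j
... | yes i≡j = contradiction i≡j i≢j
... | no  _   = refl

⌊≟⌋-sym : ∀ {n} (i j : Fin n) → ⌊ i ≟ j ⌋ ≡ ⌊ j ≟ i ⌋
⌊≟⌋-sym i j with i ≟ j
... | yes refl = sym (⌊≟⌋-refl i)
... | no  i≢j  = sym (⌊≟⌋-≢ (i≢j ∘ sym))

∑-𝟙≟ : ∀ {n} (i : Fin n) (f : Fin n → ℚ) → ∑ (λ k → 𝟙 ⌊ k ≟ i ⌋ * f k) ≡ f i
∑-𝟙≟ {suc n} zero    f = trans
  (cong₂ _+_ (ℚₚ.*-identityˡ (f zero)) (trans (∑-cong (λ k → ℚₚ.*-zeroˡ (f (suc k)))) (∑-zero n)))
  (ℚₚ.+-identityʳ (f zero))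
∑-𝟙≟ (suc i) f = trans
  (cong₂ _+_ (ℚₚ.*-zeroˡ (f zero)) (trans
    (∑-cong λ k → cong (λ b → 𝟙 b * f (suc k)) (⌊suc≟suc⌋ k i))
    (∑-𝟙≟ i (f ∘ suc))))
  (ℚₚ.+-identityˡ (f (suc i)))

sumExcept-+ : ∀ {n} (i : Fin n) (f : Fin n → ℚ) → sumExcept i f + f i ≡ ∑ f
sumExcept-+ i f = begin
  sumExcept i f + f i                               ≡⟨ cong (λ z → sumExcept i f + z) (∑-𝟙≟ i f) ⟨
  sumExcept i f + ∑ (λ k → 𝟙 ⌊ k ≟ i ⌋ * f k)       ≡⟨ Sumℚ.∑-distrib-+ _ (λ k → 𝟙 ⌊ k ≟ i ⌋ * f k) ⟨
  ∑ (λ k → (if ⌊ k ≟ i ⌋ then 0ℚ else f k) + 𝟙 ⌊ k ≟ i ⌋ * f k)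
                                                    ≡⟨ ∑-cong (λ k → split ⌊ k ≟ i ⌋ (f k)) ⟩
  ∑ f                                               ∎
  where
  split : ∀ b x → (if b then 0ℚ else x) + 𝟙 b * x ≡ x
  split true  x = trans (ℚₚ.+-identityˡ _) (ℚₚ.*-identityˡ x)
  split false x = trans (cong (λ z → x + z) (ℚₚ.*-zeroˡ x)) (ℚₚ.+-identityʳ x)

sumExcept-cong : ∀ {n} (i : Fin n) {f g : Fin n → ℚ} → (∀ k → k ≢ i → f k ≡ g k) →
  sumExcept i f ≡ sumExcept i g
sumExcept-cong i f≡g = ∑-cong λ k → lemma k
  where
  lemma : ∀ k → (if ⌊ k ≟ i ⌋ then 0ℚ else _) ≡ (if ⌊ k ≟ i ⌋ then 0ℚ else _)
  lemma k with k ≟ i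
  ... | yes _   = refl
  ... | no  k≢i = f≡g k k≢i

sumExcept-mono : ∀ {n} (i : Fin n) {f g : Fin n → ℚ} → (∀ k → k ≢ i → f k ≤ g k) →
  sumExcept i f ≤ sumExcept i g
sumExcept-mono i f≤g = ∑-mono λ k → lemma k
  where
  lemma : ∀ k → (if ⌊ k ≟ i ⌋ then 0ℚ else _) ≤ (if ⌊ k ≟ i ⌋ then 0ℚ else _)
  lemma k with k ≟ i
  ... | yes _   = ℚₚ.≤-refl
  ... | no  k≢i = f≤g k k≢i

sumExcept-+-distrib : ∀ {n} (i : Fin n) (f g : Fin n → ℚ) →
  sumExcept i (λ k → f k + g k) ≡ sumExcept i f + sumExcept i g
sumExcept-+-distrib {n} i f g = trans (∑-cong λ k → lemma ⌊ k ≟ i ⌋ (f k) (g k)) (Sumℚ.∑-distrib-+ {n} _ _)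
  where
  lemma : ∀ b x y → (if b then 0ℚ else x + y) ≡ (if b then 0ℚ else x) + (if b then 0ℚ else y)
  lemma true  x y = refl
  lemma false x y = refl

sumExcept-*ˡ : ∀ {n} (i : Fin n) c (f : Fin n → ℚ) → sumExcept i (λ k → c * f k) ≡ c * sumExcept i f
sumExcept-*ˡ {n} i c f = trans (∑-cong λ k → lemma ⌊ k ≟ i ⌋ (f k)) (∑-*ˡ {n} c _)
  where
  lemma : ∀ b x → (if b then 0ℚ else c * x) ≡ c * (if b then 0ℚ else x)
  lemma true  x = sym (ℚₚ.*-zeroʳ c)
  lemma false x = refl

sumExcept-≡∑ : ∀ {n} (i : Fin n) (f : Fin n → ℚ) → f i ≡ 0ℚ → sumExcept i f ≡ ∑ f
sumExcept-≡∑ i f fi≡0 = begin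
  sumExcept i f         ≡⟨ ℚₚ.+-identityʳ (sumExcept i f) ⟨
  sumExcept i f + 0ℚ    ≡⟨ cong (λ z → sumExcept i f + z) fi≡0 ⟨
  sumExcept i f + f i   ≡⟨ sumExcept-+ i f ⟩
  ∑ f                   ∎

-- Mean first passage times

upper-bound : ∀ {n} (f : Fin n → ℚ) → ∃ λ B → ∀ k → f k ≤ ι B
upper-bound {zero}  f = 0 , λ ()
upper-bound {suc n} f = proj₁ head ℕ.+ proj₁ tail , λ where
    zero    → ℚₚ.≤-trans (proj₂ head) (ι-mono-≤ (ℕₚ.m≤m+n _ _))
    (suc k) → ℚₚ.≤-trans (proj₂ tail k) (ι-mono-≤ (ℕₚ.m≤n+m _ (proj₁ head)))
  where
  head = ≤-ceiling (f zero)
  tail = upper-bound (f ∘ suc)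

partial-sum-telescopes : ∀ (a G : ℕ → ℚ) → (∀ t → a t ≡ G t - G (suc t)) →
  ∀ N → ∑ {N} (a ∘ toℕ) ≡ G 0 - G N
partial-sum-telescopes a G a≡ΔG zero    = sym (ℚₚ.+-inverseʳ (G 0))
partial-sum-telescopes a G a≡ΔG (suc N) = begin
  a 0 + ∑ {N} (a ∘ suc ∘ toℕ)
    ≡⟨ cong₂ _+_ (a≡ΔG 0) (partial-sum-telescopes (a ∘ suc) (G ∘ suc) (a≡ΔG ∘ suc) N) ⟩
  (G 0 - G 1) + (G 1 - G (suc N))      ≡⟨ lemma (G 0) (G 1) (G (suc N)) ⟩
  G 0 - G (suc N)                      ∎
  where
  lemma : ∀ x y z → (x - y) + (y - z) ≡ x - z
  lemma = solve-∀ ℚ-ring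

-- The remainder after N terms is exactly `G N`, so a rate C / N for `G` suffices and the
-- Archimedean property supplies the threshold.
telescoping-HasSum : ∀ (a G : ℕ → ℚ) C → (∀ t → a t ≡ G t - G (suc t)) →
  (∀ N → 0ℚ ≤ G (suc N)) → (∀ N → ι N * G (suc N) ≤ C) → a HasSum G 0
-- `K` satisfies C < δ K. From `suc K` on, every index is some `suc N` with K ≤ N, so N · G (suc N)
-- ≤ C < δ K ≤ N δ, and N cancels.
telescoping-HasSum a G C a≡ΔG 0≤G NG≤C δ 0<δ = suc K , λ where
    (suc N) (ℕ.s≤s K≤N) → subst (_< δ) (sym (distance (suc N) (0≤G N)))
      (ℚₚ.*-cancelˡ-<-nonNeg (ι N) {{nonNegative (0≤ι N)}} (ℚₚ.≤-<-trans (NG≤C N)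
        (ℚₚ.<-≤-trans C<δK (subst (δ * ι K ≤_) (ℚₚ.*-comm δ (ι N)) (*-monoˡ-≤ (ℚₚ.<⇒≤ 0<δ) (ι-mono-≤ K≤N))))))
  where
  K = proj₁ (archimedean 0<δ C)
  C<δK = proj₂ (archimedean 0<δ C)
  cancel : ∀ x y → (x - y) - x ≡ - y
  cancel = solve-∀ ℚ-ring
  distance : ∀ N → 0ℚ ≤ G N → ∣ ∑ {N} (a ∘ toℕ) - G 0 ∣ ≡ G N
  distance N 0≤GN = begin
    ∣ ∑ {N} (a ∘ toℕ) - G 0 ∣ ≡⟨ cong (λ z → ∣ z - G 0 ∣) (partial-sum-telescopes a G a≡ΔG N) ⟩
    ∣ (G 0 - G N) - G 0 ∣     ≡⟨ cong ∣_∣ (cancel (G 0) (G N)) ⟩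
    ∣ - G N ∣                 ≡⟨ ℚₚ.∣-p∣≡∣p∣ (G N) ⟩
    ∣ G N ∣                   ≡⟨ ℚₚ.0≤p⇒∣p∣≡p 0≤GN ⟩
    G N                       ∎

0≤transition : ∀ {n} (H : Graph n) i k → 0ℚ ≤ transition H i k
0≤transition H i k with adj H i k
... | true  = 0≤ratio 1 (deg H i)
... | false = ℚₚ.≤-refl

module FirstPassage {n : ℕ} (H : Graph n) (j : Fin n) (h : Fin n → ℚ)
  (row-sum : ∀ i → i ≢ j → ∑ (transition H i) ≡ 1ℚ)
  (0≤h : ∀ i → 0ℚ ≤ h i)
  (first-step : ∀ i → i ≢ j → h i ≡ 1ℚ + sumExcept j (λ k → transition H i k * h k))
  where

  killed : (Fin n → ℚ) → Fin n → ℚ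
  killed f i = sumExcept j λ k → transition H i k * f k

  killed-cong : ∀ {f g} → (∀ k → k ≢ j → f k ≡ g k) → ∀ i → killed f i ≡ killed g i
  killed-cong f≡g i = sumExcept-cong j λ k k≢j → cong (transition H i k *_) (f≡g k k≢j)

  killed-mono : ∀ {f g} → (∀ k → k ≢ j → f k ≤ g k) → ∀ i → killed f i ≤ killed g i
  killed-mono f≤g i = sumExcept-mono j λ k k≢j → *-monoˡ-≤ (0≤transition H i k) (f≤g k k≢j)

  killed-+ : ∀ f g i → killed (λ k → f k + g k) i ≡ killed f i + killed g i
  killed-+ f g i = trans
    (sumExcept-cong j λ k _ → ℚₚ.*-distribˡ-+ (transition H i k) (f k) (g k))
    (sumExcept-+-distrib j (λ k → transition H i k * f k) (λ k → transition H i k * g k))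

  killed-*ˡ : ∀ c f i → killed (λ k → c * f k) i ≡ c * killed f i
  killed-*ˡ c f i = trans
    (sumExcept-cong j λ k _ → rearrange (transition H i k) c (f k))
    (sumExcept-*ˡ j c (λ k → transition H i k * f k))
    where
    rearrange : ∀ p c x → p * (c * x) ≡ c * (p * x)
    rearrange = solve-∀ ℚ-ring

  killed-0 : ∀ i → killed (λ _ → 0ℚ) i ≡ 0ℚ
  killed-0 i = trans (killed-cong (λ _ _ → sym (ℚₚ.*-zeroˡ 0ℚ)) i)
    (trans (killed-*ˡ 0ℚ (λ _ → 0ℚ) i) (ℚₚ.*-zeroˡ (killed (λ _ → 0ℚ) i)))

  -- The probability that the walk from `i` is not at `j` at any of the times 1, ..., t.
  survival : ℕ → Fin n → ℚ
  survival zero    i = 1ℚ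
  survival (suc t) i = killed (survival t) i

  -- The expected remaining time Σ_{s ≥ t} survival s.
  remaining : ℕ → Fin n → ℚ
  remaining zero    i = h i
  remaining (suc t) i = killed (remaining t) i

  0≤survival : ∀ t i → 0ℚ ≤ survival t i
  0≤survival zero    i = subst (0ℚ ≤_) ι-1 (0≤ι 1)
  0≤survival (suc t) i = subst (_≤ survival (suc t) i) (killed-0 i) (killed-mono (λ k _ → 0≤survival t k) i)

  0≤remaining : ∀ t i → 0ℚ ≤ remaining t i
  0≤remaining zero    i = 0≤h i
  0≤remaining (suc t) i = subst (_≤ remaining (suc t) i) (killed-0 i) (killed-mono (λ k _ → 0≤remaining t k) i)

  -- The first-step equations read h = 1 + Qh; applying Q repeatedly gives Qᵗh = Qᵗ1 + Qᵗ⁺¹h.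
  remaining-suc : ∀ t i → i ≢ j → remaining t i ≡ survival t i + remaining (suc t) i
  remaining-suc zero    i i≢j = first-step i i≢j
  remaining-suc (suc t) i i≢j = trans (killed-cong (remaining-suc t) i)
    (killed-+ (survival t) (remaining (suc t)) i)

  -- A row of the transition matrix has sum 1, which splits into the step to `j` and the steps
  -- elsewhere; Q carries this splitting to later times.
  firstPassage-suc : ∀ t i → i ≢ j → survival t i ≡ firstPassage H j (suc t) i + survival (suc t) i
  firstPassage-suc zero    i i≢j = begin
    1ℚ                                        ≡⟨ row-sum i i≢j ⟨
    ∑ (transition H i)                        ≡⟨ sumExcept-+ j (transition H i) ⟨
    sumExcept j (transition H i) + transition H i j ≡⟨ ℚₚ.+-comm _ (transition H i j) ⟩
    transition H i j + sumExcept j (transition H i)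
      ≡⟨ cong (λ z → transition H i j + z) (sumExcept-cong j λ k _ → sym (ℚₚ.*-identityʳ (transition H i k))) ⟩
    transition H i j + survival 1 i           ∎
  firstPassage-suc (suc t) i i≢j = trans (killed-cong (firstPassage-suc t) i)
    (killed-+ (firstPassage H j (suc t)) (survival (suc t)) i)

  survival≤remaining : ∀ t i → i ≢ j → survival t i ≤ remaining t i
  survival≤remaining t i i≢j = subst₂ _≤_ (ℚₚ.+-identityʳ _) (sym (remaining-suc t i i≢j))
    (ℚₚ.+-monoʳ-≤ (survival t i) (0≤remaining (suc t) i))

  -- The successor gives B ≥ 1, hence 4B - 1 ≥ 0, which `remaining-moment-bound` relies on.
  B : ℕ
  B = suc (proj₁ (upper-bound h))

  remaining≤B*survival : ∀ t i → i ≢ j → remaining t i ≤ ι B * survival t i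
  remaining≤B*survival zero    i _ = subst (h i ≤_) (sym (ℚₚ.*-identityʳ (ι B)))
    (ℚₚ.≤-trans (proj₂ (upper-bound h) i) (ι-mono-≤ (ℕₚ.n≤1+n _)))
  remaining≤B*survival (suc t) i _ = subst (remaining (suc t) i ≤_) (killed-*ˡ (ι B) (survival t) i)
    (killed-mono (remaining≤B*survival t) i)

  -- Let c = t + 2B, u = `remaining t i` and s = `survival t i`. Passing to `suc t` lowers c² u by
  -- c² s - (2c + 1)(u - s). As u ≤ B s, this is at least (c² + (2c + 1)(1 - B)) s; the shift 2B
  -- makes c² - 2cB equal to c t, and then every term is nonnegative.
  scale : ℕ → ℚ
  scale t = ι t + (ι B + ι B)

  0≤scale : ∀ t → 0ℚ ≤ scale t
  0≤scale t = 0≤p+q (0≤ι t) (0≤p+q (0≤ι B) (0≤ι B))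

  -- The tail decays geometrically; quadratic decay is all that the moments below need.
  scale²*remaining-suc : ∀ t i → i ≢ j →
    scale (suc t) * scale (suc t) * remaining (suc t) i ≤ scale t * scale t * remaining t i
  scale²*remaining-suc t i i≢j = 0≤q-p⇒p≤q (subst (0ℚ ≤_) (sym eq)
    (0≤p+q (0≤p*q (0≤p+q (0≤p+q (0≤scale t) (0≤scale t)) 0≤1) (p≤q⇒0≤q-p (remaining≤B*survival t i i≢j)))
      (0≤p*q (0≤p+q (0≤p+q (0≤p*q (0≤ι t) (0≤p+q (0≤scale t) 0≤1)) (0≤scale t)) (0≤p+q (0≤ι B) 0≤1))
        (0≤survival t i))))
    where
    0≤1 = 0≤survival 0 i
    expand : ∀ t b s u′ →
      (t + (b + b)) * (t + (b + b)) * (s + u′) - (1ℚ + t + (b + b)) * (1ℚ + t + (b + b)) * u′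
      ≡ (t + (b + b) + (t + (b + b)) + 1ℚ) * (b * s - (s + u′))
        + (t * (t + (b + b) + 1ℚ) + (t + (b + b)) + (b + 1ℚ)) * s
    expand = solve-∀ ℚ-ring
    eq : scale t * scale t * remaining t i - scale (suc t) * scale (suc t) * remaining (suc t) i
      ≡ (scale t + scale t + 1ℚ) * (ι B * survival t i - remaining t i)
        + (ι t * (scale t + 1ℚ) + scale t + (ι B + 1ℚ)) * survival t i
    eq = trans
      (cong₂ (λ u c → scale t * scale t * u - (c + (ι B + ι B)) * (c + (ι B + ι B)) * remaining (suc t) i)
        (remaining-suc t i i≢j) (ι-suc t))
      (trans (expand (ι t) (ι B) (survival t i) (remaining (suc t) i))
        (cong (λ u → (scale t + scale t + 1ℚ) * (ι B * survival t i - u)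
          + (ι t * (scale t + 1ℚ) + scale t + (ι B + 1ℚ)) * survival t i)
          (sym (remaining-suc t i i≢j))))

  scale²*remaining-bound : ∀ t i → i ≢ j →
    scale t * scale t * remaining t i ≤ scale 0 * scale 0 * h i
  scale²*remaining-bound zero    i i≢j = ℚₚ.≤-refl
  scale²*remaining-bound (suc t) i i≢j =
    ℚₚ.≤-trans (scale²*remaining-suc t i i≢j) (scale²*remaining-bound t i i≢j)

  -- By Abel summation the bracket is the tail of the first moment, the sum of s ·
  -- `firstPassage H j s i` over s > t. It is controlled by (t + 2B)² u because `survival` is at
  -- most `remaining`, so t² of the square pays for the second summand and the cross term 4B t for
  -- the first.
  remaining-moment-bound : ∀ t i → i ≢ j →
    ι t * (remaining t i + ι t * survival t i) ≤ scale 0 * scale 0 * h i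
  remaining-moment-bound t i i≢j = ℚₚ.≤-trans (0≤q-p⇒p≤q (subst (0ℚ ≤_) (sym eq)
    (0≤p+q
      (0≤p*q (0≤p+q (0≤p*q (0≤ι t) (0≤p+q 0≤1+2b 0≤2b)) (0≤p*q 0≤2b 0≤2b)) (0≤remaining t i))
      (0≤p*q (0≤p*q (0≤ι t) (0≤ι t)) (p≤q⇒0≤q-p (survival≤remaining t i i≢j))))))
    (scale²*remaining-bound t i i≢j)
    where
    b = ι (proj₁ (upper-bound h))
    0≤b = 0≤ι (proj₁ (upper-bound h))
    0≤1 = 0≤survival 0 i
    0≤1+2b = 0≤p+q 0≤1 (0≤p+q 0≤b 0≤b)
    0≤2b = 0≤p+q (0≤p+q 0≤1 0≤b) (0≤p+q 0≤1 0≤b)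
    expand : ∀ t b s u →
      (t + (1ℚ + b + (1ℚ + b))) * (t + (1ℚ + b + (1ℚ + b))) * u - t * (u + t * s)
      ≡ (t * (1ℚ + (b + b) + (1ℚ + b + (1ℚ + b))) + (1ℚ + b + (1ℚ + b)) * (1ℚ + b + (1ℚ + b))) * u
        + t * t * (u - s)
    expand = solve-∀ ℚ-ring
    eq : scale t * scale t * remaining t i - ι t * (remaining t i + ι t * survival t i)
      ≡ (ι t * (1ℚ + (b + b) + (1ℚ + b + (1ℚ + b))) + (1ℚ + b + (1ℚ + b)) * (1ℚ + b + (1ℚ + b))) * remaining t i
        + ι t * ι t * (remaining t i - survival t i)
    eq = trans
      (cong (λ c → (ι t + (c + c)) * (ι t + (c + c)) * remaining t i - ι t * (remaining t i + ι t * survival t i))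
        (ι-suc (proj₁ (upper-bound h))))
      (expand (ι t) b (survival t i) (remaining t i))

  survival-moment-bound : ∀ t i → i ≢ j → ι t * survival t i ≤ scale 0 * scale 0 * h i
  survival-moment-bound t i i≢j = ℚₚ.≤-trans
    (*-monoˡ-≤ (0≤ι t) (ℚₚ.≤-trans (survival≤remaining t i i≢j)
      (subst (_≤ remaining t i + ι t * survival t i) (ℚₚ.+-identityʳ _)
        (ℚₚ.+-monoʳ-≤ (remaining t i) (0≤p*q (0≤ι t) (0≤survival t i))))))
    (remaining-moment-bound t i i≢j)

  firstPassage-HasSum-1 : ∀ i → i ≢ j → (λ t → firstPassage H j t i) HasSum 1ℚ
  firstPassage-HasSum-1 i i≢j = telescoping-HasSum _ tail (scale 0 * scale 0 * h i) increment
    (λ t → 0≤survival t i) (λ t → survival-moment-bound t i i≢j)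
    where
    tail : ℕ → ℚ
    -- The term at time 0 vanishes, so the tails at indices 0 and 1 agree; the survival
    -- probabilities are therefore shifted by one.
    tail zero    = 1ℚ
    tail (suc t) = survival t i
    cancel : ∀ f s → f ≡ (f + s) - s
    cancel = solve-∀ ℚ-ring
    increment : ∀ t → firstPassage H j t i ≡ tail t - tail (suc t)
    increment zero    = refl
    increment (suc t) = trans (cancel (firstPassage H j (suc t) i) (survival (suc t) i))
      (cong (_- survival (suc t) i) (sym (firstPassage-suc t i i≢j)))

  firstPassage-moment-HasSum : ∀ i → i ≢ j → (λ t → (+ t / 1) * firstPassage H j t i) HasSum h i
  firstPassage-moment-HasSum i i≢j = telescoping-HasSum _ tail (scale 0 * scale 0 * h i) increment
    (λ t → 0≤p+q (0≤remaining t i) (0≤p*q (0≤ι t) (0≤survival t i)))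
    (λ t → remaining-moment-bound t i i≢j)
    where
    tail : ℕ → ℚ
    tail zero    = h i
    tail (suc t) = remaining t i + ι t * survival t i
    expand : ∀ t f s u → (1ℚ + t) * f ≡ (f + s + u + t * (f + s)) - (u + (1ℚ + t) * s)
    expand = solve-∀ ℚ-ring
    initial : ∀ x y → 0ℚ * x ≡ y - (y + 0ℚ * 1ℚ)
    initial = solve-∀ ℚ-ring
    increment : ∀ t → (+ t / 1) * firstPassage H j t i ≡ tail t - tail (suc t)
    increment zero    = trans (initial 0ℚ (h i)) (cong (λ z → h i - (h i + z * 1ℚ)) (sym ι-0))
    increment (suc t) = begin
      (+ suc t / 1) * f                        ≡⟨ cong (_* f) (trans (sym (ι-def (suc t))) (ι-suc t)) ⟩
      (1ℚ + ι t) * f                           ≡⟨ expand (ι t) f s u ⟩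
      (f + s + u + ι t * (f + s)) - (u + (1ℚ + ι t) * s)
        ≡⟨ cong₂ (λ x y → (x + u + ι t * x) - (u + y * s)) (sym (firstPassage-suc t i i≢j)) (sym (ι-suc t)) ⟩
      (survival t i + u + ι t * survival t i) - tail (suc (suc t))
        ≡⟨ cong (λ z → (z + ι t * survival t i) - tail (suc (suc t))) (sym (remaining-suc t i i≢j)) ⟩
      tail (suc t) - tail (suc (suc t))        ∎
      where
      f = firstPassage H j (suc t) i
      s = survival (suc t) i
      u = remaining (suc t) i

  isMeanFirstPassageTime : ∀ i → i ≢ j → IsMeanFirstPassageTime H i j (h i)
  isMeanFirstPassageTime i i≢j = firstPassage-HasSum-1 i i≢j , firstPassage-moment-HasSum i i≢j

-- Kemeny's constant of a graph with a tree metric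

degℚ : ∀ {n} → Graph n → Fin n → ℚ
degℚ H i = ι (deg H i)

degℚ-∑ : ∀ {n} (H : Graph n) i → degℚ H i ≡ ∑ (λ k → 𝟙 (adj H i k))
degℚ-∑ H i = ι-card (adj H i)

volume : ∀ {n} → Graph n → ℚ
volume H = ∑ (degℚ H)

𝟙-adj-split : ∀ {n} (H : Graph n) x y →
  𝟙 (adj H x y) ≡ 𝟙 (⌊ x <? y ⌋ ∧ adj H x y) + 𝟙 (⌊ y <? x ⌋ ∧ adj H y x)
𝟙-adj-split H x y with x <? y | y <? x
... | yes x<y | yes y<x = contradiction y<x (ℕₚ.<-asym x<y)
... | yes _   | no  _   = sym (ℚₚ.+-identityʳ _)
... | no  _   | yes _   = trans (cong 𝟙 (symm H x y)) (sym (ℚₚ.+-identityˡ _))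
... | no  x≮y | no  y≮x with Finₚ.toℕ-injective (ℕₚ.≤-antisym (ℕₚ.≮⇒≥ y≮x) (ℕₚ.≮⇒≥ x≮y))
...   | refl = cong 𝟙 (loopless H x)

-- The edge count is the sum over the upper triangle of the adjacency matrix. Adding its transpose
-- restores the whole matrix, whose row sums are the degrees.
handshake : ∀ {n} (H : Graph n) → ι (2 ℕ.* edgeCount H) ≡ volume H
handshake {n} H = begin
  ι (edgeCount H ℕ.+ (edgeCount H ℕ.+ 0))
    ≡⟨ cong ι (cong (edgeCount H ℕ.+_) (ℕₚ.+-identityʳ (edgeCount H))) ⟩
  ι (edgeCount H ℕ.+ edgeCount H)           ≡⟨ ι-+ (edgeCount H) (edgeCount H) ⟩
  ι (edgeCount H) + ι (edgeCount H)         ≡⟨ cong₂ _+_ upper (trans upper (Sumℚ.∑-comm {n} {n} up)) ⟩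
  ∑ (λ x → ∑ (up x)) + ∑ (λ x → ∑ λ y → up y x) ≡⟨ Sumℚ.∑-distrib-+ (λ x → ∑ (up x)) (λ x → ∑ λ y → up y x) ⟨
  ∑ (λ x → ∑ (up x) + ∑ (λ y → up y x))
    ≡⟨ ∑-cong {n} (λ x → sym (Sumℚ.∑-distrib-+ (up x) (λ y → up y x))) ⟩
  ∑ (λ x → ∑ (λ y → up x y + up y x))
    ≡⟨ ∑-cong {n} (λ x → trans (∑-cong {n} λ y → sym (𝟙-adj-split H x y)) (sym (degℚ-∑ H x))) ⟩
  volume H                                  ∎
  where
  up : Fin n → Fin n → ℚ
  up x y = 𝟙 (⌊ x <? y ⌋ ∧ adj H x y)
  upper : ι (edgeCount H) ≡ ∑ (λ x → ∑ (up x))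
  upper = trans (ι-∑ (λ x → card (tabulate λ y → ⌊ x <? y ⌋ ∧ adj H x y))) (∑-cong {n} λ x → ι-card (λ y → ⌊ x <? y ⌋ ∧ adj H x y))

-- The last field says that every neighbour of i is one step further from j
-- than i is, except for a single neighbour, if i ≢ j, which is one step closer.
record TreeMetric {n : ℕ} (H : Graph n) (r : Fin n → Fin n → ℚ) : Set where
  field
    0≤r          : ∀ i j → 0ℚ ≤ r i j
    r-refl       : ∀ i → r i i ≡ 0ℚ
    r-sym        : ∀ i j → r i j ≡ r j i
    r-triangle   : ∀ i j k → r i k ≤ r i j + r j k
    ∑-neighbours : ∀ i j → ∑ (λ k → 𝟙 (adj H i k) * r k j) ≡
      degℚ H i * (r i j + 1ℚ) + (𝟙 ⌊ i ≟ j ⌋ + 𝟙 ⌊ i ≟ j ⌋) - (1ℚ + 1ℚ)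

weightedDistance : ∀ {n} → Graph n → (Fin n → Fin n → ℚ) → Fin n → ℚ
weightedDistance H r i = ∑ λ k → degℚ H k * r i k

wienerSum : ∀ {n} → Graph n → (Fin n → Fin n → ℚ) → ℚ
wienerSum H r = ∑ λ i → degℚ H i * weightedDistance H r i

½-double : ∀ x → ½ * (x + x) ≡ x
½-double x = trans (lemma ½ x) (ℚₚ.*-identityˡ x)
  where
  lemma : ∀ h x → h * (x + x) ≡ (h + h) * x
  lemma = solve-∀ ℚ-ring

0≤½ : 0ℚ ≤ ½
0≤½ = 0≤ratio 1 2

module Kemeny {n : ℕ} (H : Graph n) (r : Fin n → Fin n → ℚ) (metric : TreeMetric H r)
  (edgeCount≢0 : 2 ℕ.* edgeCount H ≢ 0) where

  open TreeMetric metric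

  private
    d : Fin n → ℚ
    d = degℚ H
    D : Fin n → ℚ
    D = weightedDistance H r
    M : ℚ
    M = volume H

  -- Exchange the sums and weight `∑-neighbours i l` by `d l`: the Kronecker term contributes
  -- `d i + d i`, the constant -2 contributes -(M + M).
  ∑-adj-D : ∀ i → ∑ (λ k → 𝟙 (adj H i k) * D k) ≡
    d i * (D i + M) + (d i + d i) - (M + M)
  ∑-adj-D i = begin
    ∑ (λ k → 𝟙 (adj H i k) * D k)
      ≡⟨ ∑-cong {n} (λ k → sym (∑-*ˡ (𝟙 (adj H i k)) (λ l → d l * r k l))) ⟩
    ∑ (λ k → ∑ λ l → 𝟙 (adj H i k) * (d l * r k l))
      ≡⟨ Sumℚ.∑-comm {n} {n} (λ k l → 𝟙 (adj H i k) * (d l * r k l)) ⟩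
    ∑ (λ l → ∑ λ k → 𝟙 (adj H i k) * (d l * r k l))
      ≡⟨ ∑-cong {n} (λ l → trans (∑-cong {n} λ k → swap (𝟙 (adj H i k)) (d l) (r k l)) (∑-*ˡ (d l) (λ k → 𝟙 (adj H i k) * r k l))) ⟩
    ∑ (λ l → d l * ∑ λ k → 𝟙 (adj H i k) * r k l)
      ≡⟨ ∑-cong {n} (λ l → trans (cong (d l *_) (∑-neighbours i l)) (expand (d l) (d i) (r i l) (𝟙 ⌊ i ≟ l ⌋))) ⟩
    ∑ (λ l → (d i * (d l * r i l) + d i * d l + δ l) - (d l + d l))
      ≡⟨ ∑-- (λ l → d i * (d l * r i l) + d i * d l + δ l) (λ l → d l + d l) ⟩
    ∑ (λ l → d i * (d l * r i l) + d i * d l + δ l) - ∑ (λ l → d l + d l)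
      ≡⟨ cong₂ _-_ part (Sumℚ.∑-distrib-+ d d) ⟩
    d i * D i + d i * M + (d i + d i) - (M + M)
      ≡⟨ cong (λ z → z + (d i + d i) - (M + M)) (sym (ℚₚ.*-distribˡ-+ (d i) (D i) M)) ⟩
    d i * (D i + M) + (d i + d i) - (M + M) ∎
    where
    δ : Fin n → ℚ
    δ l = 𝟙 ⌊ i ≟ l ⌋ * d l + 𝟙 ⌊ i ≟ l ⌋ * d l
    swap : ∀ a b c → a * (b * c) ≡ b * (a * c)
    swap = solve-∀ ℚ-ring
    expand : ∀ dl di x e → dl * (di * (x + 1ℚ) + (e + e) - (1ℚ + 1ℚ)) ≡
      (di * (dl * x) + di * dl + (e * dl + e * dl)) - (dl + dl)
    expand = solve-∀ ℚ-ring
    ∑-𝟙i : ∑ (λ l → 𝟙 ⌊ i ≟ l ⌋ * d l) ≡ d i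
    ∑-𝟙i = trans (∑-cong {n} λ l → cong (λ b → 𝟙 b * d l) (⌊≟⌋-sym i l)) (∑-𝟙≟ i d)
    part : ∑ (λ l → d i * (d l * r i l) + d i * d l + δ l) ≡ d i * D i + d i * M + (d i + d i)
    part = trans (Sumℚ.∑-distrib-+ (λ l → d i * (d l * r i l) + d i * d l) δ) (cong₂ _+_
      (trans (Sumℚ.∑-distrib-+ (λ l → d i * (d l * r i l)) (λ l → d i * d l))
        (cong₂ _+_ (∑-*ˡ (d i) (λ l → d l * r i l)) (∑-*ˡ (d i) d)))
      (trans (Sumℚ.∑-distrib-+ (λ l → 𝟙 ⌊ i ≟ l ⌋ * d l) (λ l → 𝟙 ⌊ i ≟ l ⌋ * d l)) (cong₂ _+_ ∑-𝟙i ∑-𝟙i)))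

  -- Twice the resistance formula for hitting times.
  twiceHit : Fin n → Fin n → ℚ
  twiceHit j i = M * r i j + D j - D i

  hit : Fin n → Fin n → ℚ
  hit j i = ½ * twiceHit j i

  hit-refl : ∀ j → hit j j ≡ 0ℚ
  hit-refl j = trans (cong (½ *_) (trans (cong (λ z → M * z + D j - D j) (r-refl j)) (lemma M (D j)))) (ℚₚ.*-zeroʳ ½)
    where
    lemma : ∀ m x → m * 0ℚ + x - x ≡ 0ℚ
    lemma = solve-∀ ℚ-ring

  -- `twiceHit j i` is the degree-weighted sum over k of the defects r i j + r j k - r i k in the
  -- triangle inequality.
  0≤hit : ∀ j i → 0ℚ ≤ hit j i
  0≤hit j i = 0≤p*q 0≤½ (subst (0ℚ ≤_) eq (0≤∑ λ k → 0≤p*q (0≤ι (deg H k)) (p≤q⇒0≤q-p (r-triangle i j k))))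
    where
    expand : ∀ x a b c → x * (a + b - c) ≡ (x * a + x * b) - x * c
    expand = solve-∀ ℚ-ring
    eq : ∑ (λ k → d k * (r i j + r j k - r i k)) ≡ twiceHit j i
    eq = trans (∑-cong {n} λ k → expand (d k) (r i j) (r j k) (r i k))
      (trans (∑-- (λ k → d k * r i j + d k * r j k) (λ k → d k * r i k))
        (cong (_- D i) (trans (Sumℚ.∑-distrib-+ (λ k → d k * r i j) (λ k → d k * r j k))
          (cong (_+ D j) (∑-*ʳ (r i j) d)))))

  -- This is the first-step equation multiplied by 2 d i. The coefficient `M` of the distance is
  -- chosen so that its -2M from the closer neighbour cancels the 2M coming from `∑-adj-D`.
  ∑-adj-twiceHit : ∀ i j → i ≢ j → ∑ (λ k → 𝟙 (adj H i k) * twiceHit j k) ≡ d i * twiceHit j i - (d i + d i)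
  ∑-adj-twiceHit i j i≢j = begin
    ∑ (λ k → 𝟙 (adj H i k) * twiceHit j k)
      ≡⟨ ∑-cong {n} (λ k → expand (𝟙 (adj H i k)) M (r k j) (D j) (D k)) ⟩
    ∑ (λ k → (M * (𝟙 (adj H i k) * r k j) + 𝟙 (adj H i k) * D j) - 𝟙 (adj H i k) * D k)
      ≡⟨ ∑-- (λ k → M * (𝟙 (adj H i k) * r k j) + 𝟙 (adj H i k) * D j) (λ k → 𝟙 (adj H i k) * D k) ⟩
    ∑ (λ k → M * (𝟙 (adj H i k) * r k j) + 𝟙 (adj H i k) * D j) - ∑ (λ k → 𝟙 (adj H i k) * D k)
      ≡⟨ cong₂ _-_ part (∑-adj-D i) ⟩
    M * (d i * (r i j + 1ℚ) - (1ℚ + 1ℚ)) + d i * D j - (d i * (D i + M) + (d i + d i) - (M + M))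
      ≡⟨ collect M (d i) (r i j) (D j) (D i) ⟩
    d i * twiceHit j i - (d i + d i) ∎
    where
    expand : ∀ a m x y z → a * (m * x + y - z) ≡ (m * (a * x) + a * y) - a * z
    expand = solve-∀ ℚ-ring
    collect : ∀ m d x y z →
      m * (d * (x + 1ℚ) - (1ℚ + 1ℚ)) + d * y - (d * (z + m) + (d + d) - (m + m)) ≡ d * (m * x + y - z) - (d + d)
    collect = solve-∀ ℚ-ring
    neighbours : ∑ (λ k → 𝟙 (adj H i k) * r k j) ≡ d i * (r i j + 1ℚ) - (1ℚ + 1ℚ)
    neighbours = trans (∑-neighbours i j) (trans
      (cong (λ b → d i * (r i j + 1ℚ) + (𝟙 b + 𝟙 b) - (1ℚ + 1ℚ)) (⌊≟⌋-≢ i≢j))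
      (cong (_- (1ℚ + 1ℚ)) (ℚₚ.+-identityʳ (d i * (r i j + 1ℚ)))))
    part : ∑ (λ k → M * (𝟙 (adj H i k) * r k j) + 𝟙 (adj H i k) * D j) ≡
      M * (d i * (r i j + 1ℚ) - (1ℚ + 1ℚ)) + d i * D j
    part = trans (Sumℚ.∑-distrib-+ (λ k → M * (𝟙 (adj H i k) * r k j)) (λ k → 𝟙 (adj H i k) * D j))
      (cong₂ _+_ (trans (∑-*ˡ M (λ k → 𝟙 (adj H i k) * r k j)) (cong (M *_) neighbours))
        (trans (∑-*ʳ (D j) (λ k → 𝟙 (adj H i k))) (cong (_* D j) (sym (degℚ-∑ H i)))))

  -- At an isolated vertex `i`, `∑-neighbours i j` would equate the empty sum 0 with -2.
  deg≢0 : ∀ i j → i ≢ j → deg H i ≢ 0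
  deg≢0 i j i≢j deg≡0 = 2≢0 (begin
    1ℚ + 1ℚ     ≡⟨ lemma (r i j) (1ℚ + 1ℚ) ⟩
    - (0ℚ * (r i j + 1ℚ) + (0ℚ + 0ℚ) - (1ℚ + 1ℚ))
      ≡⟨ cong₂ (λ x b → - (x * (r i j + 1ℚ) + (𝟙 b + 𝟙 b) - (1ℚ + 1ℚ))) (sym d≡0) (sym (⌊≟⌋-≢ i≢j)) ⟩
    - (d i * (r i j + 1ℚ) + (𝟙 ⌊ i ≟ j ⌋ + 𝟙 ⌊ i ≟ j ⌋) - (1ℚ + 1ℚ)) ≡⟨ cong -_ (sym (∑-neighbours i j)) ⟩
    - ∑ (λ k → 𝟙 (adj H i k) * r k j)
      ≡⟨ cong -_ (trans (∑-cong {n} λ k → trans (cong (_* r k j) (𝟙≡0 k)) (ℚₚ.*-zeroˡ (r k j))) (∑-zero n)) ⟩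
    0ℚ ∎)
    where
    2≢0 : 1ℚ + 1ℚ ≢ 0ℚ
    2≢0 ()
    lemma : ∀ x t → t ≡ - (0ℚ * (x + 1ℚ) + (0ℚ + 0ℚ) - t)
    lemma = solve-∀ ℚ-ring
    d≡0 : d i ≡ 0ℚ
    d≡0 = trans (cong ι deg≡0) ι-0
    𝟙≡0 : ∀ k → 𝟙 (adj H i k) ≡ 0ℚ
    𝟙≡0 k = ℚₚ.≤-antisym
      (subst₂ _≤_ (∑-𝟙≟ k (λ l → 𝟙 (adj H i l))) (trans (sym (degℚ-∑ H i)) d≡0)
        (∑-mono {n} λ l → 𝟙*≤ ⌊ l ≟ k ⌋ (0≤𝟙 (adj H i l))))
      (0≤𝟙 (adj H i k))
      where
      𝟙*≤ : ∀ b {x} → 0ℚ ≤ x → 𝟙 b * x ≤ x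
      𝟙*≤ true  {x} 0≤x = ℚₚ.≤-reflexive (ℚₚ.*-identityˡ x)
      𝟙*≤ false {x} 0≤x = subst (_≤ x) (sym (ℚₚ.*-zeroˡ x)) 0≤x

  transition-𝟙 : ∀ i k → transition H i k ≡ ratio 1 (deg H i) * 𝟙 (adj H i k)
  transition-𝟙 i k = trans (if-then (adj H i k) (ratio 1 (deg H i))) (ℚₚ.*-comm (𝟙 (adj H i k)) _)

  ratio-deg : ∀ i j → i ≢ j → ratio 1 (deg H i) * d i ≡ 1ℚ
  ratio-deg i j i≢j = trans (ratio-*-ι 1 (deg≢0 i j i≢j)) ι-1

  row-sum : ∀ j i → i ≢ j → ∑ (transition H i) ≡ 1ℚ
  row-sum j i i≢j = begin
    ∑ (transition H i)                               ≡⟨ ∑-cong {n} (transition-𝟙 i) ⟩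
    ∑ (λ k → ratio 1 (deg H i) * 𝟙 (adj H i k))      ≡⟨ ∑-*ˡ (ratio 1 (deg H i)) (λ k → 𝟙 (adj H i k)) ⟩
    ratio 1 (deg H i) * ∑ (λ k → 𝟙 (adj H i k))      ≡⟨ cong (ratio 1 (deg H i) *_) (sym (degℚ-∑ H i)) ⟩
    ratio 1 (deg H i) * d i                          ≡⟨ ratio-deg i j i≢j ⟩
    1ℚ                                               ∎

  first-step : ∀ j i → i ≢ j → hit j i ≡ 1ℚ + sumExcept j (λ k → transition H i k * hit j k)
  first-step j i i≢j = sym (begin
    1ℚ + sumExcept j (λ k → transition H i k * hit j k)
      ≡⟨ cong (λ z → 1ℚ + z) (sumExcept-≡∑ j (λ k → transition H i k * hit j k)
           (trans (cong (transition H i j *_) (hit-refl j)) (ℚₚ.*-zeroʳ (transition H i j)))) ⟩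
    1ℚ + ∑ (λ k → transition H i k * hit j k)
      ≡⟨ cong (λ z → 1ℚ + z) (trans (∑-cong {n} λ k → trans (cong (_* hit j k) (transition-𝟙 i k))
           (rearrange (ratio 1 (deg H i)) (𝟙 (adj H i k)) ½ (twiceHit j k)))
           (∑-*ˡ (ratio 1 (deg H i) * ½) (λ k → 𝟙 (adj H i k) * twiceHit j k))) ⟩
    1ℚ + ratio 1 (deg H i) * ½ * ∑ (λ k → 𝟙 (adj H i k) * twiceHit j k)
      ≡⟨ cong (λ z → 1ℚ + ratio 1 (deg H i) * ½ * z) (∑-adj-twiceHit i j i≢j) ⟩
    1ℚ + ratio 1 (deg H i) * ½ * (d i * twiceHit j i - (d i + d i))
      ≡⟨ expand (ratio 1 (deg H i)) ½ (d i) (twiceHit j i) ⟩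
    1ℚ + (ratio 1 (deg H i) * d i) * (½ * twiceHit j i - ½ * (1ℚ + 1ℚ))
      ≡⟨ cong₂ (λ x y → 1ℚ + x * (hit j i - y)) (ratio-deg i j i≢j) (½-double 1ℚ) ⟩
    1ℚ + 1ℚ * (hit j i - 1ℚ)
      ≡⟨ simplify (hit j i) ⟩
    hit j i ∎)
    where
    rearrange : ∀ c a h x → c * a * (h * x) ≡ c * h * (a * x)
    rearrange = solve-∀ ℚ-ring
    expand : ∀ c h d x → 1ℚ + c * h * (d * x - (d + d)) ≡ 1ℚ + (c * d) * (h * x - h * (1ℚ + 1ℚ))
    expand = solve-∀ ℚ-ring
    simplify : ∀ x → 1ℚ + 1ℚ * (x - 1ℚ) ≡ x
    simplify = solve-∀ ℚ-ring

  kemeny : ℚ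
  kemeny = ratio 1 (2 ℕ.* edgeCount H) * ½ * wienerSum H r

  stationary-deg : ∀ j → stationary H j ≡ ratio 1 (2 ℕ.* edgeCount H) * d j
  stationary-deg j = begin
    stationary H j                          ≡⟨ ℚₚ.*-identityʳ _ ⟨
    stationary H j * 1ℚ                     ≡⟨ cong (stationary H j *_) (sym ratio-m) ⟩
    stationary H j * (ratio 1 m * ι m)      ≡⟨ rearrange (stationary H j) (ratio 1 m) (ι m) ⟩
    ratio 1 m * (stationary H j * ι m)      ≡⟨ cong (ratio 1 m *_) (ratio-*-ι (deg H j) edgeCount≢0) ⟩
    ratio 1 m * d j                         ∎
    where
    m = 2 ℕ.* edgeCount H
    ratio-m : ratio 1 m * ι m ≡ 1ℚ
    ratio-m = trans (ratio-*-ι 1 edgeCount≢0) ι-1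
    rearrange : ∀ s c m → s * (c * m) ≡ c * (s * m)
    rearrange = solve-∀ ℚ-ring

  isKemenyConstant : IsKemenyConstant H kemeny
  isKemenyConstant i = (λ j → hit j i) ,
    (λ j j≢i → FirstPassage.isMeanFirstPassageTime H j (hit j) (row-sum j) (0≤hit j) (first-step j) i (j≢i ∘ sym)) ,
    sym (begin
      sumExcept i (λ j → stationary H j * hit j i)
        ≡⟨ sumExcept-≡∑ i (λ j → stationary H j * hit j i)
             (trans (cong (stationary H i *_) (hit-refl i)) (ℚₚ.*-zeroʳ (stationary H i))) ⟩
      ∑ (λ j → stationary H j * hit j i)
        ≡⟨ ∑-cong {n} (λ j → trans (cong (_* hit j i) (stationary-deg j)) (expand c (d j) ½ M (r i j) (D j) (D i))) ⟩
      ∑ (λ j → c * ½ * (M * (d j * r i j) + d j * D j - d j * D i))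
        ≡⟨ ∑-*ˡ (c * ½) (λ j → M * (d j * r i j) + d j * D j - d j * D i) ⟩
      c * ½ * ∑ (λ j → M * (d j * r i j) + d j * D j - d j * D i)
        ≡⟨ cong (c * ½ *_) (trans
             (∑-- (λ j → M * (d j * r i j) + d j * D j) (λ j → d j * D i))
             (cong₂ _-_
               (trans (Sumℚ.∑-distrib-+ (λ j → M * (d j * r i j)) (λ j → d j * D j))
                 (cong (_+ wienerSum H r) (∑-*ˡ M (λ j → d j * r i j))))
               (∑-*ʳ (D i) d))) ⟩
      c * ½ * (M * D i + wienerSum H r - M * D i)
        ≡⟨ cong (c * ½ *_) (cancel (M * D i) (wienerSum H r)) ⟩
      kemeny ∎)
    where
    c = ratio 1 (2 ℕ.* edgeCount H)
    expand : ∀ c d h m x y z → c * d * (h * (m * x + y - z)) ≡ c * h * (m * (d * x) + d * y - d * z)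
    expand = solve-∀ ℚ-ring
    cancel : ∀ x y → x + y - x ≡ y
    cancel = solve-∀ ℚ-ring

-- Reduced walks and distances in trees

-- Reduced H a x y l: walks from x to y of length l that never backtrack and
-- whose first step does not lead to a.
data Reduced {n : ℕ} (H : Graph n) : Fin n → Fin n → Fin n → ℕ → Set where
  []   : ∀ {a x} → Reduced H a x x 0
  step : ∀ {a x z y l} → Adj H x z → z ≢ a → Reduced H x z y l → Reduced H a x y (suc l)

module _ {n : ℕ} (H : Graph n) where

  Adj-sym : ∀ {x y} → Adj H x y → Adj H y x
  Adj-sym {x} {y} = subst T (symm H x y)

  Adj⇒≢ : ∀ {x y} → Adj H x y → x ≢ y
  Adj⇒≢ {x} x~x refl = subst T (loopless H x) x~x

module _ {n : ℕ} {H : Graph n} where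

  -- Without loops no first step leads to `x` itself, so forbidding `x` is the way to state that the
  -- first step is free.
  unconstrain : ∀ {a x y l} → Reduced H a x y l → Reduced H x x y l
  unconstrain []              = []
  unconstrain (step x~z _ p) = step x~z (Adj⇒≢ H x~z ∘ sym) p

  -- Run `p` backwards to `x`, cross the edge to `a` and continue with the other walk; the two
  -- forbidden vertices rule out backtracking at both ends of that edge. The recursion moves the
  -- steps of `p` one by one to the front of the other walk.
  glue : ∀ {a x y w k l} → Reduced H a x y k → Adj H x a → Reduced H x a w l →
    Reduced H y y w (k ℕ.+ suc l)
  glue []                      x~a q = step x~a (Adj⇒≢ H x~a ∘ sym) q
  glue (step {l = k} x~z z≢a p) x~a q =
    subst (Reduced H _ _ _) (ℕₚ.+-suc k _) (glue p (Adj-sym H x~z) (step x~a (z≢a ∘ sym) q))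

  reverse : ∀ {x y l} → Reduced H x x y l → Reduced H y y x l
  reverse []                      = []
  reverse (step {l = l} x~z z≢x p) =
    subst (Reduced H _ _ _) (ℕₚ.+-comm l 1) (glue p (Adj-sym H x~z) [])

  -- When `z` turns out to be a vertex already passed, the walk is cut off there, so its length is
  -- left open; otherwise the comparison provides the `z ≢ x` that the recursive call asks for.
  snoc : ∀ {a x y z l} → Reduced H a x y l → Adj H y z → z ≢ a → ∃ (Reduced H a x z)
  snoc []                       y~z z≢a = 1 , step y~z z≢a []
  snoc {x = x} {z = z} (step x~w w≢a p) y~z z≢a with z ≟ x
  ... | yes refl = 0 , []
  ... | no  z≢x  = _ , step x~w w≢a (proj₂ (snoc p y~z z≢x))

  reduce : ∀ {x y} → Star (Adj H) x y → ∃ (Reduced H x x y)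
  reduce ε = 0 , []
  reduce {x} (x~z ◅ w) with reduce w
  ... | _ , [] = 1 , step x~z (Adj⇒≢ H x~z ∘ sym) []
  ... | _ , p@(step {z = z′} z~z′ z′≢z q) with z′ ≟ x
  ...   | yes refl = _ , unconstrain q
  ...   | no  z′≢x = _ , step x~z (Adj⇒≢ H x~z ∘ sym) (step z~z′ z′≢x q)

  -- The endpoint is left out, so that a closed walk does not list its base point twice.
  vertex : ∀ {a x y l} → Reduced H a x y l → Fin l → Fin n
  vertex {x = x} (step _ _ p) zero    = x
  vertex         (step _ _ p) (suc i) = vertex p i

  vertex-Adj : ∀ {a x y l} (p : Reduced H a x y (suc l)) (i : Fin l) →
    Adj H (vertex p (inject₁ i)) (vertex p (suc i))
  vertex-Adj (step x~z _ (step _ _ _))   zero    = x~z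
  vertex-Adj (step _ _ p@(step _ _ _)) (suc i) = vertex-Adj p i

  vertex-last-Adj : ∀ {a x y l} (p : Reduced H a x y (suc l)) → Adj H (vertex p (fromℕ l)) y
  vertex-last-Adj (step x~y _ [])               = x~y
  vertex-last-Adj (step _ _ p@(step _ _ _)) = vertex-last-Adj p

  prefix : ∀ {a x y l} (p : Reduced H a x y l) (i : Fin l) → Reduced H a x (vertex p i) (toℕ i)
  prefix (step _ _ _)       zero    = []
  prefix (step x~z z≢a p) (suc i) = step x~z z≢a (prefix p i)

  -- The stretch between two occurrences of a vertex is a closed reduced walk of length at most m,
  -- which the hypothesis excludes.
  vertex-injective : ∀ {m} → (∀ {k} → k ℕ.< m → ∀ {a x} → ¬ Reduced H a x x (suc k)) →
    ∀ {a x y l} → l ℕ.≤ suc m → (p : Reduced H a x y l) → Injective _≡_ _≡_ (vertex p)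
  vertex-injective ¬closed l≤m p@(step _ _ _) {zero}  {zero}  _  = refl
  vertex-injective ¬closed l≤m p@(step _ _ q) {zero}  {suc i} eq =
    contradiction (subst (λ v → Reduced H _ _ v _) (sym eq) (prefix p (suc i)))
      (¬closed (ℕₚ.<-≤-trans (Finₚ.toℕ<n i) (ℕₚ.≤-pred l≤m)))
  vertex-injective ¬closed l≤m p@(step _ _ q) {suc i} {zero}  eq =
    contradiction (subst (λ v → Reduced H _ _ v _) eq (prefix p (suc i)))
      (¬closed (ℕₚ.<-≤-trans (Finₚ.toℕ<n i) (ℕₚ.≤-pred l≤m)))
  vertex-injective ¬closed l≤m (step _ _ q) {suc i} {suc j} eq =
    cong suc (vertex-injective ¬closed (ℕₚ.≤-trans (ℕₚ.n≤1+n _) l≤m) q eq)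

  -- Strong induction on the length. Length 1 would be a loop and length 2 a backtrack; from length
  -- 3 on, the absence of shorter closed reduced walks makes the vertices distinct, so the walk is a
  -- cycle.
  no-closed-reduced : Acyclic H → ∀ {l a x} → ¬ Reduced H a x x (suc l)
  no-closed-reduced acyclic {l} = go (ℕᵢ.<-wellFounded l)
    where
    go : ∀ {l} → Acc ℕ._<_ l → ∀ {a x} → ¬ Reduced H a x x (suc l)
    go _         (step x~x _ [])                    = Adj⇒≢ H x~x refl
    go _         (step _ _ (step _ x≢x []))         = x≢x refl
    go (acc rec) p@(step _ _ (step _ _ (step _ _ _))) = acyclic
      (_ , vertex p , vertex-injective (λ k<l → go (rec k<l)) ℕₚ.≤-refl p , vertex-Adj p , vertex-last-Adj p)

  -- v is attached behind z by a reduced walk that p continues, so p cannot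
  -- return to v.
  avoids : Acyclic H → ∀ {v b z x k l} → Reduced H b z x l → Adj H z b → Reduced H z b v k →
    Star (AdjWithout H v) z x
  avoids acyclic []                z~b q = ε
  avoids acyclic {v} (step {z = y} z~y y≢b p) z~b q =
    (not-v q′ , not-v (step (Adj-sym H z~y) (Adj⇒≢ H z~y) q′) , z~y) ◅ avoids acyclic p (Adj-sym H z~y) q′
    where
    q′ = step z~b (y≢b ∘ sym) q
    not-v : ∀ {a w l} → Reduced H a w v (suc l) → w ≢ v
    not-v c refl = no-closed-reduced acyclic c

-- Distances, neighbour sums and transmission in a tree.

module TreeWalks {n : ℕ} (H : Graph n) (tree : IsTree H) where

  private
    connected = proj₂ (proj₁ tree)
    acyclic   = proj₂ tree

  -- Two walks to `y` with different first steps would glue at `x` into a closed reduced walk based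
  -- at `y`.
  first-step-unique : ∀ {x z w y k l} → Adj H x z → Reduced H x z y k → Adj H x w → Reduced H x w y l → z ≡ w
  first-step-unique {z = z} {w} x~z p x~w q with z ≟ w
  ... | yes z≡w = z≡w
  ... | no  z≢w = contradiction
    (subst (Reduced H _ _ _) (ℕₚ.+-suc _ _) (glue p (Adj-sym H x~z) (step x~w (z≢w ∘ sym) q)))
    (no-closed-reduced acyclic)

  length-unique : ∀ {a b x y k l} → Reduced H a x y k → Reduced H b x y l → k ≡ l
  length-unique []                 []                 = refl
  length-unique []                 q@(step _ _ _)     = contradiction q (no-closed-reduced acyclic)
  length-unique p@(step _ _ _)     []                 = contradiction p (no-closed-reduced acyclic)
  length-unique (step x~z _ p) (step x~w _ q) with first-step-unique x~z p x~w q
  ... | refl = cong suc (length-unique p q)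

  dist : Fin n → Fin n → ℕ
  dist x y = proj₁ (reduce {H = H} (connected x y))

  path : ∀ x y → Reduced H x x y (dist x y)
  path x y = proj₂ (reduce {H = H} (connected x y))

  dist-≡ : ∀ {a x y l} → Reduced H a x y l → dist x y ≡ l
  dist-≡ {x = x} {y} p = length-unique (path x y) p

  dist-refl : ∀ x → dist x x ≡ 0
  dist-refl x = dist-≡ {a = x} []

  dist-sym : ∀ x y → dist x y ≡ dist y x
  dist-sym x y = sym (dist-≡ (reverse (path x y)))

  -- The two sides of the edge v u, with `near` on the side of `u`. A reduced walk from one end that
  -- does not start across the edge stays reduced when the edge is put in front, whence the distance
  -- equations.
  data Side (v u x : Fin n) : Set where
    near : ∀ {l} → Reduced H v u x l → dist v x ≡ suc (dist u x) → Side v u x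
    far  : ∀ {l} → Reduced H u v x l → dist u x ≡ suc (dist v x) → Side v u x

  far-side : ∀ {v u x l} → Adj H v u → Reduced H u v x l → Side v u x
  far-side v~u p = far p (trans (dist-≡ (step (Adj-sym H v~u) (Adj⇒≢ H v~u) p)) (cong suc (sym (dist-≡ p))))

  near-side : ∀ {v u x l} → Adj H v u → Reduced H v u x l → Side v u x
  near-side v~u p = near p (trans (dist-≡ (step v~u (Adj⇒≢ H v~u ∘ sym) p)) (cong suc (sym (dist-≡ p))))

  side : ∀ {v u} → Adj H v u → ∀ x → Side v u x
  side {v} {u} v~u x = go (path v x)
    where
    go : ∀ {l} → Reduced H v v x l → Side v u x
    go [] = far-side v~u []
    go (step {z = z} v~z z≢v p) with z ≟ u
    ... | yes refl = near-side v~u p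
    ... | no  z≢u  = far-side v~u (step v~z z≢u p)

  dist-step-≤ : ∀ {x z} → Adj H x z → ∀ y → dist x y ℕ.≤ suc (dist z y)
  dist-step-≤ x~z y with side x~z y
  ... | near _ eq = ℕₚ.≤-reflexive eq
  ... | far  _ eq = ℕₚ.≤-trans (ℕₚ.n≤1+n _) (ℕₚ.≤-trans (ℕₚ.≤-reflexive (sym eq)) (ℕₚ.n≤1+n _))

  dist-triangle : ∀ x y z → dist x z ℕ.≤ dist x y ℕ.+ dist y z
  dist-triangle x y z = go (path x y)
    where
    go : ∀ {a x l} → Reduced H a x y l → dist x z ℕ.≤ l ℕ.+ dist y z
    go []             = ℕₚ.≤-refl
    go (step x~w _ p) = ℕₚ.≤-trans (dist-step-≤ x~w z) (ℕ.s≤s (go p))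

  module _ (g : ℕ → ℚ) (j : Fin n) where

    ∑-neighbours-self : ∑ (λ k → 𝟙 (adj H j k) * g (dist k j)) ≡ degℚ H j * g 1
    ∑-neighbours-self = begin
      ∑ (λ k → 𝟙 (adj H j k) * g (dist k j)) ≡⟨ ∑-cong {n} pointwise ⟩
      ∑ (λ k → 𝟙 (adj H j k) * g 1)          ≡⟨ ∑-*ʳ (g 1) (λ k → 𝟙 (adj H j k)) ⟩
      ∑ (λ k → 𝟙 (adj H j k)) * g 1          ≡⟨ cong (_* g 1) (sym (degℚ-∑ H j)) ⟩
      degℚ H j * g 1                         ∎
      where
      pointwise : ∀ k → 𝟙 (adj H j k) * g (dist k j) ≡ 𝟙 (adj H j k) * g 1
      pointwise k with adj H j k in eq
      ... | true  = cong (λ l → 1ℚ * g l) (dist-≡ {a = k} (step k~j (Adj⇒≢ H k~j ∘ sym) []))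
        where k~j = Adj-sym H (subst T (sym eq) _)
      ... | false = trans (ℚₚ.*-zeroˡ (g (dist k j))) (sym (ℚₚ.*-zeroˡ (g 1)))

    -- All neighbours are counted at distance `suc (suc l)`, then the value at the single closer
    -- neighbour `z` is corrected. The function `g` is later both the distance and its square.
    ∑-neighbours-other : ∀ {i z l} → Adj H i z → Reduced H i z j l →
      ∑ (λ k → 𝟙 (adj H i k) * g (dist k j)) ≡ degℚ H i * g (suc (suc l)) + (g l - g (suc (suc l)))
    ∑-neighbours-other {i} {z} {l} i~z p = begin
      ∑ (λ k → 𝟙 (adj H i k) * g (dist k j))                        ≡⟨ ∑-cong {n} pointwise ⟩
      ∑ (λ k → 𝟙 (adj H i k) * g₂ + 𝟙 ⌊ k ≟ z ⌋ * (g l - g₂))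
        ≡⟨ Sumℚ.∑-distrib-+ (λ k → 𝟙 (adj H i k) * g₂) (λ k → 𝟙 ⌊ k ≟ z ⌋ * (g l - g₂)) ⟩
      ∑ (λ k → 𝟙 (adj H i k) * g₂) + ∑ (λ k → 𝟙 ⌊ k ≟ z ⌋ * (g l - g₂))
        ≡⟨ cong₂ _+_ (trans (∑-*ʳ g₂ (λ k → 𝟙 (adj H i k))) (cong (_* g₂) (sym (degℚ-∑ H i)))) (∑-𝟙≟ z (λ _ → g l - g₂)) ⟩
      degℚ H i * g₂ + (g l - g₂)                                    ∎
      where
      g₂ = g (suc (suc l))
      at-z : ∀ x y → 1ℚ * x ≡ 1ℚ * y + 1ℚ * (x - y)
      at-z = solve-∀ ℚ-ring
      off-z : ∀ x y → 1ℚ * y ≡ 1ℚ * y + 0ℚ * (x - y)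
      off-z = solve-∀ ℚ-ring
      non-adjacent : ∀ w x y → 0ℚ * w ≡ 0ℚ * y + 0ℚ * (x - y)
      non-adjacent = solve-∀ ℚ-ring
      pointwise : ∀ k → 𝟙 (adj H i k) * g (dist k j) ≡ 𝟙 (adj H i k) * g₂ + 𝟙 ⌊ k ≟ z ⌋ * (g l - g₂)
      pointwise k with adj H i k in eq | k ≟ z
      ... | true  | yes refl = trans (cong (λ l → 1ℚ * g l) (dist-≡ p)) (at-z (g l) g₂)
      ... | true  | no  k≢z  = trans
        (cong (λ l → 1ℚ * g l) (dist-≡ {a = k} (step (Adj-sym H i~k) (Adj⇒≢ H i~k) (step i~z (k≢z ∘ sym) p))))
        (off-z (g l) g₂)
        where i~k = subst T (sym eq) _
      ... | false | yes refl = contradiction (subst T eq i~z) (λ ())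
      ... | false | no  _    = non-adjacent (g (dist k j)) (g l) g₂

  distℚ : Fin n → Fin n → ℚ
  distℚ x y = ι (dist x y)

  treeMetric : TreeMetric H distℚ
  treeMetric = record
    { 0≤r          = λ i j → 0≤ι (dist i j)
    ; r-refl       = λ i → trans (cong ι (dist-refl i)) ι-0
    ; r-sym        = λ i j → cong ι (dist-sym i j)
    ; r-triangle   = λ i j k → subst (distℚ i k ≤_) (ι-+ (dist i j) (dist j k)) (ι-mono-≤ (dist-triangle i j k))
    ; ∑-neighbours = neighbours
    }
    where
    self : ∀ d → d * 1ℚ ≡ d * (0ℚ + 1ℚ) + (1ℚ + 1ℚ) - (1ℚ + 1ℚ)
    self = solve-∀ ℚ-ring
    other : ∀ d x → d * (1ℚ + (1ℚ + x)) + (x - (1ℚ + (1ℚ + x))) ≡ d * ((1ℚ + x) + 1ℚ) + (0ℚ + 0ℚ) - (1ℚ + 1ℚ)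
    other = solve-∀ ℚ-ring
    neighbours : ∀ i j → ∑ (λ k → 𝟙 (adj H i k) * distℚ k j) ≡
      degℚ H i * (distℚ i j + 1ℚ) + (𝟙 ⌊ i ≟ j ⌋ + 𝟙 ⌊ i ≟ j ⌋) - (1ℚ + 1ℚ)
    neighbours i j with i ≟ j
    ... | yes refl = trans (∑-neighbours-self ι i) (trans (cong (degℚ H i *_) ι-1) (trans (self (degℚ H i))
      (cong (λ x → degℚ H i * (x + 1ℚ) + (1ℚ + 1ℚ) - (1ℚ + 1ℚ)) (sym (trans (cong ι (dist-refl i)) ι-0)))))
    ... | no  i≢j  = go (path i j)
      where
      go : ∀ {l} → Reduced H i i j l → ∑ (λ k → 𝟙 (adj H i k) * distℚ k j) ≡
        degℚ H i * (distℚ i j + 1ℚ) + (0ℚ + 0ℚ) - (1ℚ + 1ℚ)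
      go [] = contradiction refl i≢j
      go q@(step {l = l} i~z _ p) = begin
        ∑ (λ k → 𝟙 (adj H i k) * distℚ k j) ≡⟨ ∑-neighbours-other ι j i~z p ⟩
        degℚ H i * ι (suc (suc l)) + (ι l - ι (suc (suc l)))
          ≡⟨ cong (λ x → degℚ H i * x + (ι l - x)) (trans (ι-suc (suc l)) (cong (λ x → 1ℚ + x) (ι-suc l))) ⟩
        degℚ H i * (1ℚ + (1ℚ + ι l)) + (ι l - (1ℚ + (1ℚ + ι l)))  ≡⟨ other (degℚ H i) (ι l) ⟩
        degℚ H i * ((1ℚ + ι l) + 1ℚ) + (0ℚ + 0ℚ) - (1ℚ + 1ℚ)
          ≡⟨ cong (λ x → degℚ H i * (x + 1ℚ) + (0ℚ + 0ℚ) - (1ℚ + 1ℚ)) (trans (sym (ι-suc l)) (cong ι (sym (dist-≡ q)))) ⟩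
        degℚ H i * (distℚ i j + 1ℚ) + (0ℚ + 0ℚ) - (1ℚ + 1ℚ) ∎

  transmission : Fin n → ℕ
  transmission v = Sumℕ.sum (dist v)

  -- The closer neighbour has (r - 1)² = (r + 1)² - 4 r. The correction 4 r vanishes at `i ≡ j`,
  -- where no neighbour is closer, so no Kronecker term appears.
  ∑-neighbours-square : ∀ i j → ∑ (λ k → 𝟙 (adj H i k) * (distℚ k j * distℚ k j)) ≡
    degℚ H i * ((distℚ i j + 1ℚ) * (distℚ i j + 1ℚ)) - (1ℚ + 1ℚ + (1ℚ + 1ℚ)) * distℚ i j
  ∑-neighbours-square i j = go (path i j)
    where
    self : ∀ d t → d * (1ℚ * 1ℚ) ≡ d * ((0ℚ + 1ℚ) * (0ℚ + 1ℚ)) - t * 0ℚ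
    self = solve-∀ ℚ-ring
    other : ∀ d x → d * ((1ℚ + (1ℚ + x)) * (1ℚ + (1ℚ + x))) + (x * x - (1ℚ + (1ℚ + x)) * (1ℚ + (1ℚ + x))) ≡
      d * (((1ℚ + x) + 1ℚ) * ((1ℚ + x) + 1ℚ)) - (1ℚ + 1ℚ + (1ℚ + 1ℚ)) * (1ℚ + x)
    other = solve-∀ ℚ-ring
    square : ℕ → ℚ
    square l = ι l * ι l
    go : ∀ {i l} → Reduced H i i j l → ∑ (λ k → 𝟙 (adj H i k) * (distℚ k j * distℚ k j)) ≡
      degℚ H i * ((distℚ i j + 1ℚ) * (distℚ i j + 1ℚ)) - (1ℚ + 1ℚ + (1ℚ + 1ℚ)) * distℚ i j
    go [] = begin
      ∑ (λ k → 𝟙 (adj H j k) * square (dist k j)) ≡⟨ ∑-neighbours-self square j ⟩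
      degℚ H j * square 1 ≡⟨ cong (λ x → degℚ H j * (x * x)) ι-1 ⟩
      degℚ H j * (1ℚ * 1ℚ) ≡⟨ self (degℚ H j) (1ℚ + 1ℚ + (1ℚ + 1ℚ)) ⟩
      degℚ H j * ((0ℚ + 1ℚ) * (0ℚ + 1ℚ)) - (1ℚ + 1ℚ + (1ℚ + 1ℚ)) * 0ℚ
        ≡⟨ cong (λ x → degℚ H j * ((x + 1ℚ) * (x + 1ℚ)) - (1ℚ + 1ℚ + (1ℚ + 1ℚ)) * x) (sym (trans (cong ι (dist-refl j)) ι-0)) ⟩
      degℚ H j * ((distℚ j j + 1ℚ) * (distℚ j j + 1ℚ)) - (1ℚ + 1ℚ + (1ℚ + 1ℚ)) * distℚ j j ∎
    go {i} q@(step {l = l} i~z _ p) = begin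
      ∑ (λ k → 𝟙 (adj H i k) * square (dist k j)) ≡⟨ ∑-neighbours-other square j i~z p ⟩
      degℚ H i * square (suc (suc l)) + (square l - square (suc (suc l)))
        ≡⟨ cong (λ x → degℚ H i * (x * x) + (square l - x * x)) (trans (ι-suc (suc l)) (cong (λ x → 1ℚ + x) (ι-suc l))) ⟩
      degℚ H i * ((1ℚ + (1ℚ + ι l)) * (1ℚ + (1ℚ + ι l))) + (square l - (1ℚ + (1ℚ + ι l)) * (1ℚ + (1ℚ + ι l)))
        ≡⟨ other (degℚ H i) (ι l) ⟩
      degℚ H i * (((1ℚ + ι l) + 1ℚ) * ((1ℚ + ι l) + 1ℚ)) - (1ℚ + 1ℚ + (1ℚ + 1ℚ)) * (1ℚ + ι l)
        ≡⟨ cong (λ x → degℚ H i * ((x + 1ℚ) * (x + 1ℚ)) - (1ℚ + 1ℚ + (1ℚ + 1ℚ)) * x) (trans (sym (ι-suc l)) (cong ι (sym (dist-≡ q)))) ⟩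
      degℚ H i * ((distℚ i j + 1ℚ) * (distℚ i j + 1ℚ)) - (1ℚ + 1ℚ + (1ℚ + 1ℚ)) * distℚ i j ∎

  -- Double counting Σ_{k ~ i} dist k j ² over the ordered pairs of adjacent vertices.
  weightedDistance-transmission : ∀ j →
    weightedDistance H distℚ j + weightedDistance H distℚ j + volume H ≡ (1ℚ + 1ℚ + (1ℚ + 1ℚ)) * ι (transmission j)
  weightedDistance-transmission j = begin
    D + D + volume H ≡⟨ isolate D (volume H) E (four * ι (transmission j)) ⟩
    (E + (D + D) + volume H - four * ι (transmission j)) - E + four * ι (transmission j)
      ≡⟨ cong (λ z → z - E + four * ι (transmission j)) (trans (sym doubleSum) doubleSum′) ⟩
    E - E + four * ι (transmission j) ≡⟨ cancel E (four * ι (transmission j)) ⟩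
    four * ι (transmission j) ∎
    where
    four = 1ℚ + 1ℚ + (1ℚ + 1ℚ)
    D = weightedDistance H distℚ j
    d : Fin n → ℚ
    d = degℚ H
    r : Fin n → ℚ
    r i = distℚ i j
    E : ℚ
    E = ∑ λ i → d i * (r i * r i)
    isolate : ∀ x v e w → x + x + v ≡ (e + (x + x) + v - w) - e + w
    isolate = solve-∀ ℚ-ring
    cancel : ∀ e w → e - e + w ≡ w
    cancel = solve-∀ ℚ-ring
    expand : ∀ d x t → d * ((x + 1ℚ) * (x + 1ℚ)) - t * x ≡ (d * (x * x) + (d * x + d * x) + d) - t * x
    expand = solve-∀ ℚ-ring
    D-sym : ∑ (λ i → d i * r i) ≡ D
    D-sym = ∑-cong {n} λ i → cong (λ l → d i * ι l) (dist-sym i j)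
    transmission-∑ : ∑ r ≡ ι (transmission j)
    transmission-∑ = trans (∑-cong {n} λ i → cong ι (dist-sym i j)) (sym (ι-∑ (dist j)))
    doubleSum : ∑ (λ i → ∑ λ k → 𝟙 (adj H i k) * (r k * r k)) ≡ E + (D + D) + volume H - four * ι (transmission j)
    doubleSum = begin
      ∑ (λ i → ∑ λ k → 𝟙 (adj H i k) * (r k * r k))
        ≡⟨ ∑-cong {n} (λ i → trans (∑-neighbours-square i j) (expand (d i) (r i) four)) ⟩
      ∑ (λ i → (d i * (r i * r i) + (d i * r i + d i * r i) + d i) - four * r i)
        ≡⟨ ∑-- (λ i → d i * (r i * r i) + (d i * r i + d i * r i) + d i) (λ i → four * r i) ⟩
      ∑ (λ i → d i * (r i * r i) + (d i * r i + d i * r i) + d i) - ∑ (λ i → four * r i)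
        ≡⟨ cong₂ _-_
             (trans (Sumℚ.∑-distrib-+ (λ i → d i * (r i * r i) + (d i * r i + d i * r i)) d)
               (cong (_+ volume H) (trans (Sumℚ.∑-distrib-+ (λ i → d i * (r i * r i)) (λ i → d i * r i + d i * r i))
                 (cong (λ z → E + z) (trans (Sumℚ.∑-distrib-+ (λ i → d i * r i) (λ i → d i * r i)) (cong₂ _+_ D-sym D-sym))))))
             (trans (∑-*ˡ four r) (cong (four *_) transmission-∑)) ⟩
      E + (D + D) + volume H - four * ι (transmission j) ∎
    -- Grouped by `k` instead of `i`, each square occurs `d k` times; hence `E` cancels and only
    -- linear terms remain.
    doubleSum′ : ∑ (λ i → ∑ λ k → 𝟙 (adj H i k) * (r k * r k)) ≡ E
    doubleSum′ = begin
      ∑ (λ i → ∑ λ k → 𝟙 (adj H i k) * (r k * r k))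
        ≡⟨ Sumℚ.∑-comm {n} {n} (λ i k → 𝟙 (adj H i k) * (r k * r k)) ⟩
      ∑ (λ k → ∑ λ i → 𝟙 (adj H i k) * (r k * r k))
        ≡⟨ ∑-cong {n} (λ k → trans (∑-*ʳ (r k * r k) (λ i → 𝟙 (adj H i k)))
           (cong (_* (r k * r k)) (trans (∑-cong {n} λ i → cong 𝟙 (symm H i k)) (sym (degℚ-∑ H k))))) ⟩
      E ∎

-- Centroids

∈-tabulate⁺ : ∀ {n} (b : Fin n → Bool) {x} → b x ≡ true → x ∈ tabulate b
∈-tabulate⁺ b {x} bx≡true = lookup⇒[]= x (tabulate b) (trans (lookup∘tabulate b x) bx≡true)

∈-tabulate⁻ : ∀ {n} (b : Fin n → Bool) {x} → x ∈ tabulate b → b x ≡ true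
∈-tabulate⁻ b {x} x∈ = trans (sym (lookup∘tabulate b x)) ([]=⇒lookup x∈)

n≤⌊m/2⌋⇒n+n≤m : ∀ {n m} → n ℕ.≤ ⌊ m /2⌋ → n ℕ.+ n ℕ.≤ m
n≤⌊m/2⌋⇒n+n≤m {n} {m} n≤⌊m/2⌋ = ℕₚ.≤-trans
  (ℕₚ.+-mono-≤ n≤⌊m/2⌋ (ℕₚ.≤-trans n≤⌊m/2⌋ (ℕₚ.⌊n/2⌋≤⌈n/2⌉ m)))
  (ℕₚ.≤-reflexive (ℕₚ.⌊n/2⌋+⌈n/2⌉≡n m))

n+n≤m⇒n≤⌊m/2⌋ : ∀ {n m} → n ℕ.+ n ℕ.≤ m → n ℕ.≤ ⌊ m /2⌋
n+n≤m⇒n≤⌊m/2⌋ {n} {m} n+n≤m = subst (ℕ._≤ ⌊ m /2⌋) (sym (ℕₚ.n≡⌊n+n/2⌋ n)) (ℕₚ.⌊n/2⌋-mono n+n≤m)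

module Centroids {n : ℕ} (H : Graph n) (tree : IsTree H) where

  open TreeWalks H tree

  isNear : ∀ {v u x} → Side v u x → Bool
  isNear (near _ _) = true
  isNear (far _ _)  = false

  branch : ∀ {v u} → Adj H v u → Subset n
  branch v~u = tabulate λ x → isNear (side v~u x)

  ∈-branch⁺ : ∀ {v u x l} (v~u : Adj H v u) → Reduced H v u x l → x ∈ branch v~u
  ∈-branch⁺ {v} {u} {x} v~u p = ∈-tabulate⁺ (λ x → isNear (side v~u x)) (lemma (side v~u x))
    where
    lemma : (s : Side v u x) → isNear s ≡ true
    lemma (near _ _) = refl
    -- Both descriptions together would give dist v x = 2 + dist v x.
    lemma (far _ eq) = contradiction
      (trans (dist-≡ (step v~u (Adj⇒≢ H v~u ∘ sym) p)) (cong suc (trans (sym (dist-≡ p)) eq)))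
      (ℕₚ.<⇒≢ (ℕₚ.m≤n⇒m≤1+n ℕₚ.≤-refl))

  -- The invariant along a walk in H - v is a reduced walk from `u` that does not start towards `v`;
  -- `snoc` preserves it as long as `v` is not entered.
  branch-walk : ∀ {v u y x} → Star (AdjWithout H v) y x → ∃ (Reduced H v u y) → ∃ (Reduced H v u x)
  branch-walk ε                       p       = p
  branch-walk ((_ , z≢v , y~z) ◅ w) (_ , p) = branch-walk w (snoc p y~z z≢v)

  branch-component : ∀ {v u} (v~u : Adj H v u) → IsComponentWithout H v (branch v~u)
  branch-component {v} {u} v~u = u , Adj⇒≢ H v~u ∘ sym , λ x → mk⇔
    (λ x∈ → star (side v~u x) (∈-tabulate⁻ (λ x → isNear (side v~u x)) x∈))
    (λ w → ∈-branch⁺ v~u (proj₂ (branch-walk w (0 , []))))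
    where
    star : ∀ {x} (s : Side v u x) → isNear s ≡ true → Star (AdjWithout H v) u x
    star (near p _) _ = avoids (proj₂ tree) p (Adj-sym H v~u) []

  -- The first step from `v` towards the base point of the component selects the branch. An
  -- inclusion is enough for bounding sizes.
  component⊆branch : ∀ {v S} → IsComponentWithout H v S →
    ∃ λ u → ∃ λ (v~u : Adj H v u) → card S ℕ.≤ card (branch v~u)
  component⊆branch {v} {S} (u₀ , u₀≢v , S⇔) = go (path v u₀)
    where
    go : ∀ {l} → Reduced H v v u₀ l → ∃ λ u → ∃ λ (v~u : Adj H v u) → card S ℕ.≤ card (branch v~u)
    go []               = contradiction refl u₀≢v
    go (step v~u _ p) = _ , v~u , Subsetₚ.p⊆q⇒∣p∣≤∣q∣ λ {x} x∈S →
      ∈-branch⁺ v~u (proj₂ (branch-walk (Equivalence.to (S⇔ x) x∈S) (_ , p)))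

  module _ {v u} (v~u : Adj H v u) where

    private
      χ : Fin n → ℚ
      χ x = 𝟙 (isNear (side v~u x))
      s : ℚ
      s = ι (card (branch v~u))

    -- A common shape for both sides of the pointwise comparisons below, which is why summands with
    -- coefficient `0ℚ` occur there.
    ∑-branch : ∀ w c t → ∑ (λ x → distℚ w x + c * χ x + t) ≡ ι (transmission w) + c * s + ι n * t
    ∑-branch w c t = trans (Sumℚ.∑-distrib-+ (λ x → distℚ w x + c * χ x) (λ _ → t)) (cong₂ _+_
      (trans (Sumℚ.∑-distrib-+ (distℚ w) (λ x → c * χ x)) (cong₂ _+_ (sym (ι-∑ (dist w)))
        (trans (∑-*ˡ c χ) (cong (c *_) (sym (ι-card (λ x → isNear (side v~u x))))))))
      (∑-const n t))

    transmission-neighbour : ι (transmission u) + (1ℚ + 1ℚ) * s + ι n * 0ℚ ≡ ι (transmission v) + 0ℚ * s + ι n * 1ℚ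
    transmission-neighbour = trans (sym (∑-branch u (1ℚ + 1ℚ) 0ℚ))
      (trans (∑-cong {n} λ x → pointwise (side v~u x)) (∑-branch v 0ℚ 1ℚ))
      where
      near-case : ∀ d → d + (1ℚ + 1ℚ) * 1ℚ + 0ℚ ≡ (1ℚ + d) + 0ℚ * 1ℚ + 1ℚ
      near-case = solve-∀ ℚ-ring
      far-case : ∀ d → (1ℚ + d) + (1ℚ + 1ℚ) * 0ℚ + 0ℚ ≡ d + 0ℚ * 0ℚ + 1ℚ
      far-case = solve-∀ ℚ-ring
      pointwise : ∀ {x} (s : Side v u x) →
        distℚ u x + (1ℚ + 1ℚ) * 𝟙 (isNear s) + 0ℚ ≡ distℚ v x + 0ℚ * 𝟙 (isNear s) + 1ℚ
      pointwise {x} (near _ eq) = trans (near-case (distℚ u x))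
        (cong (λ d → d + 0ℚ * 1ℚ + 1ℚ) (trans (sym (ι-suc (dist u x))) (cong ι (sym eq))))
      pointwise {x} (far _ eq) = trans
        (cong (λ d → d + (1ℚ + 1ℚ) * 0ℚ + 0ℚ) (trans (cong ι eq) (ι-suc (dist v x))))
        (far-case (distℚ v x))

    minimal⇒branch-small : transmission v ℕ.≤ transmission u → card (branch v~u) ℕ.≤ ⌊ n /2⌋
    minimal⇒branch-small W≤ = n+n≤m⇒n≤⌊m/2⌋ (ι-cancel-≤ (subst (_≤ ι n) (sym (ι-+ (card (branch v~u)) _))
      (0≤q-p⇒p≤q (subst (0ℚ ≤_) eq (p≤q⇒0≤q-p (ι-mono-≤ W≤))))))
      where
      Wv = ι (transmission v)
      Wu = ι (transmission u)
      lhs : ∀ Wu Wv s n → Wu - Wv ≡ (Wu + (1ℚ + 1ℚ) * s + n * 0ℚ) - (s + s) - Wv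
      lhs = solve-∀ ℚ-ring
      rhs : ∀ Wv s n → (Wv + 0ℚ * s + n * 1ℚ) - (s + s) - Wv ≡ n - (s + s)
      rhs = solve-∀ ℚ-ring
      eq : Wu - Wv ≡ ι n - (s + s)
      eq = trans (lhs Wu Wv s (ι n)) (trans (cong (λ z → z - (s + s) - Wv) transmission-neighbour) (rhs Wv s (ι n)))

    -- Let t be the distance from `v` to `w`. Off the branch, the path from `w` passes through `v`
    -- and distances grow by exactly t; on it, they drop by at most t by the triangle inequality.
    -- Summation gives W w - W v ≥ t (n - 2 s), nonnegative for a small branch.
    branch-small⇒≤ : ∀ {w l} → Reduced H v u w l → card (branch v~u) ℕ.≤ ⌊ n /2⌋ → transmission v ℕ.≤ transmission w
    branch-small⇒≤ {w} {l} p small = ι-cancel-≤ (0≤q-p⇒p≤q (subst (0ℚ ≤_) (sym (expand Wv Ww t s (ι n)))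
      (0≤p+q
        (p≤q⇒0≤q-p (subst₂ _≤_ (∑-branch v 0ℚ t) (∑-branch w (t + t) 0ℚ) (∑-mono {n} λ x → pointwise (side v~u x))))
        (0≤p*q (0≤ι (suc l)) (p≤q⇒0≤q-p (subst (_≤ ι n) (ι-+ (card (branch v~u)) _) (ι-mono-≤ (n≤⌊m/2⌋⇒n+n≤m small))))))))
      where
      t  = ι (suc l)
      Wv = ι (transmission v)
      Ww = ι (transmission w)
      expand : ∀ Wv Ww t s n → Ww - Wv ≡
        ((Ww + (t + t) * s + n * 0ℚ) - (Wv + 0ℚ * s + n * t)) + t * (n - (s + s))
      expand = solve-∀ ℚ-ring
      dist-v-w : dist v w ≡ suc l
      dist-v-w = dist-≡ (step v~u (Adj⇒≢ H v~u ∘ sym) p)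
      near-difference : ∀ dv dw t → (dw + (t + t) * 1ℚ + 0ℚ) - (dv + 0ℚ * 1ℚ + t) ≡ (t + dw) - dv
      near-difference = solve-∀ ℚ-ring
      far-difference : ∀ dv t → dv + 0ℚ * 0ℚ + t ≡ (t + dv) + (t + t) * 0ℚ + 0ℚ
      far-difference = solve-∀ ℚ-ring
      pointwise : ∀ {x} (s : Side v u x) →
        distℚ v x + 0ℚ * 𝟙 (isNear s) + t ≤ distℚ w x + (t + t) * 𝟙 (isNear s) + 0ℚ
      pointwise {x} (near _ _) = 0≤q-p⇒p≤q (subst (0ℚ ≤_) (sym (near-difference (distℚ v x) (distℚ w x) t))
        (p≤q⇒0≤q-p (subst (distℚ v x ≤_) (ι-+ (suc l) (dist w x)) (ι-mono-≤
          (subst (λ k → dist v x ℕ.≤ k ℕ.+ dist w x) dist-v-w (dist-triangle v w x))))))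
      pointwise {x} (far {k} q _) = ℚₚ.≤-reflexive (trans (far-difference (distℚ v x) t)
        (cong (λ d → d + (t + t) * 0ℚ + 0ℚ) (trans (sym (ι-+ (suc l) (dist v x))) (cong ι dist-w))))
        where
        dist-w : suc l ℕ.+ dist v x ≡ dist w x
        dist-w = sym (trans (dist-≡ (glue p (Adj-sym H v~u) q))
          (trans (ℕₚ.+-suc l k) (cong (λ m → suc (l ℕ.+ m)) (sym (dist-≡ q)))))

  centroid⇔minimal : ∀ v → IsCentroid H v ⇔ (∀ w → transmission v ℕ.≤ transmission w)
  centroid⇔minimal v = mk⇔ to from
    where
    to : IsCentroid H v → ∀ w → transmission v ℕ.≤ transmission w
    to centroid w = go (path v w)
      where
      go : ∀ {w l} → Reduced H v v w l → transmission v ℕ.≤ transmission w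
      go []               = ℕₚ.≤-refl
      go (step v~u _ p) = branch-small⇒≤ v~u p (centroid (branch v~u) (branch-component v~u))
    from : (∀ w → transmission v ℕ.≤ transmission w) → IsCentroid H v
    from minimal S component with component⊆branch component
    ... | u , v~u , S≤ = ℕₚ.≤-trans S≤ (minimal⇒branch-small v~u (minimal u))

-- Joining two graphs by an edge

𝟙-∧ : ∀ a b → 𝟙 (a ∧ b) ≡ 𝟙 a * 𝟙 b
𝟙-∧ true  b = sym (ℚₚ.*-identityˡ (𝟙 b))
𝟙-∧ false b = sym (ℚₚ.*-zeroˡ (𝟙 b))

𝟙≟-subst : ∀ {n} (f : Fin n → ℚ) x v → 𝟙 ⌊ x ≟ v ⌋ * f x ≡ 𝟙 ⌊ x ≟ v ⌋ * f v
𝟙≟-subst f x v with x ≟ v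
... | yes refl = refl
... | no  _    = trans (ℚₚ.*-zeroˡ (f x)) (sym (ℚₚ.*-zeroˡ (f v)))

∑-∧≟ : ∀ {n} b (v : Fin n) (f : Fin n → ℚ) → ∑ (λ y → 𝟙 (b ∧ ⌊ y ≟ v ⌋) * f y) ≡ 𝟙 b * f v
∑-∧≟ {n} b v f = begin
  ∑ (λ y → 𝟙 (b ∧ ⌊ y ≟ v ⌋) * f y)
    ≡⟨ ∑-cong {n} (λ y → trans (cong (_* f y) (𝟙-∧ b ⌊ y ≟ v ⌋)) (ℚₚ.*-assoc (𝟙 b) _ (f y))) ⟩
  ∑ (λ y → 𝟙 b * (𝟙 ⌊ y ≟ v ⌋ * f y))        ≡⟨ ∑-*ˡ (𝟙 b) (λ y → 𝟙 ⌊ y ≟ v ⌋ * f y) ⟩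
  𝟙 b * ∑ (λ y → 𝟙 ⌊ y ≟ v ⌋ * f y)          ≡⟨ cong (𝟙 b *_) (∑-𝟙≟ v f) ⟩
  𝟙 b * f v                                  ∎

∑-∧≟′ : ∀ {n} b (v : Fin n) (f : Fin n → ℚ) → ∑ (λ y → 𝟙 (⌊ y ≟ v ⌋ ∧ b) * f y) ≡ 𝟙 b * f v
∑-∧≟′ {n} b v f = trans (∑-cong {n} λ y → cong (λ b → 𝟙 b * f y) (Boolₚ.∧-comm ⌊ y ≟ v ⌋ b)) (∑-∧≟ b v f)

-- One of the two graphs that are joined, with the new edge attached at v.
module Half {n : ℕ} (H : Graph n) (r : Fin n → Fin n → ℚ) (metric : TreeMetric H r) (v : Fin n) where

  open TreeMetric metric

  private
    d : Fin n → ℚ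
    d = degℚ H

  e : Fin n → ℚ
  e x = 𝟙 ⌊ x ≟ v ⌋

  -- For a target in the same half, the neighbour gained by `v` is one step further away, so only
  -- the degree changes. The factor `e x` allows `r v y` to be replaced by `r x y`.
  ∑-neighbours-inside : ∀ x y → ∑ (λ k → 𝟙 (adj H x k) * r k y) + e x * (1ℚ + r v y) ≡
    (d x + e x) * (r x y + 1ℚ) + (𝟙 ⌊ x ≟ y ⌋ + 𝟙 ⌊ x ≟ y ⌋) - (1ℚ + 1ℚ)
  ∑-neighbours-inside x y = trans
    (cong₂ _+_ (∑-neighbours x y) (trans (ℚₚ.*-distribˡ-+ (e x) 1ℚ (r v y)) (cong (λ z → e x * 1ℚ + z) (sym (𝟙≟-subst (λ x → r x y) x v)))))
    (collect (d x) (e x) (r x y) (𝟙 ⌊ x ≟ y ⌋))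
    where
    collect : ∀ d e ρ δ → (d * (ρ + 1ℚ) + (δ + δ) - (1ℚ + 1ℚ)) + (e * 1ℚ + e * ρ) ≡
      (d + e) * (ρ + 1ℚ) + (δ + δ) - (1ℚ + 1ℚ)
    collect = solve-∀ ℚ-ring

  -- For a target beyond the new edge, at distance ρ from its other end, that end is the closer
  -- neighbour which `v` lacked. The Kronecker term of `∑-neighbours x v` is absorbed in this way;
  -- the leftover `e x * r x v` is zero.
  ∑-neighbours-across : ∀ x ρ → ∑ (λ k → 𝟙 (adj H x k) * (r k v + (1ℚ + ρ))) + e x * ρ ≡
    (d x + e x) * (r x v + (1ℚ + ρ) + 1ℚ) + (0ℚ + 0ℚ) - (1ℚ + 1ℚ)
  ∑-neighbours-across x ρ = begin
    ∑ (λ k → 𝟙 (adj H x k) * (r k v + (1ℚ + ρ))) + e x * ρ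
      ≡⟨ cong (_+ e x * ρ) (trans (∑-cong {n} λ k → ℚₚ.*-distribˡ-+ (𝟙 (adj H x k)) (r k v) (1ℚ + ρ))
           (trans (Sumℚ.∑-distrib-+ (λ k → 𝟙 (adj H x k) * r k v) (λ k → 𝟙 (adj H x k) * (1ℚ + ρ)))
             (cong₂ _+_ (∑-neighbours x v) (trans (∑-*ʳ (1ℚ + ρ) (λ k → 𝟙 (adj H x k))) (cong (_* (1ℚ + ρ)) (sym (degℚ-∑ H x))))))) ⟩
    (d x * (r x v + 1ℚ) + (e x + e x) - (1ℚ + 1ℚ)) + d x * (1ℚ + ρ) + e x * ρ
      ≡⟨ collect (d x) (e x) (r x v) ρ ⟩
    (d x + e x) * (r x v + (1ℚ + ρ) + 1ℚ) + (0ℚ + 0ℚ) - (1ℚ + 1ℚ) - e x * r x v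
      ≡⟨ cong (λ z → (d x + e x) * (r x v + (1ℚ + ρ) + 1ℚ) + (0ℚ + 0ℚ) - (1ℚ + 1ℚ) - z)
           (trans (𝟙≟-subst (λ x → r x v) x v) (trans (cong (e x *_) (r-refl v)) (ℚₚ.*-zeroʳ (e x)))) ⟩
    (d x + e x) * (r x v + (1ℚ + ρ) + 1ℚ) + (0ℚ + 0ℚ) - (1ℚ + 1ℚ) - 0ℚ
      ≡⟨ ℚₚ.+-identityʳ _ ⟩
    (d x + e x) * (r x v + (1ℚ + ρ) + 1ℚ) + (0ℚ + 0ℚ) - (1ℚ + 1ℚ) ∎
    where
    collect : ∀ d e ρ₀ ρ → (d * (ρ₀ + 1ℚ) + (e + e) - (1ℚ + 1ℚ)) + d * (1ℚ + ρ) + e * ρ ≡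
      (d + e) * (ρ₀ + (1ℚ + ρ) + 1ℚ) + (0ℚ + 0ℚ) - (1ℚ + 1ℚ) - e * ρ₀
    collect = solve-∀ ℚ-ring

  ∑-weighted : ∀ f → ∑ (λ x → (d x + e x) * f x) ≡ ∑ (λ x → d x * f x) + f v
  ∑-weighted f = trans (∑-cong {n} λ x → ℚₚ.*-distribʳ-+ (f x) (d x) (e x))
    (trans (Sumℚ.∑-distrib-+ (λ x → d x * f x) (λ x → e x * f x)) (cong (λ z → ∑ (λ x → d x * f x) + z) (∑-𝟙≟ v f)))

  private
    D : Fin n → ℚ
    D = weightedDistance H r

  ∑-weighted-distance : ∀ c → ∑ (λ x → (d x + e x) * (r x v + c)) ≡ D v + (volume H + 1ℚ) * c
  ∑-weighted-distance c = begin
    ∑ (λ x → (d x + e x) * (r x v + c))               ≡⟨ ∑-weighted (λ x → r x v + c) ⟩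
    ∑ (λ x → d x * (r x v + c)) + (r v v + c)
      ≡⟨ cong₂ (λ a b → a + (b + c))
           (trans (∑-cong {n} λ x → trans (cong (λ z → d x * (z + c)) (r-sym x v)) (ℚₚ.*-distribˡ-+ (d x) (r v x) c))
             (trans (Sumℚ.∑-distrib-+ (λ x → d x * r v x) (λ x → d x * c)) (cong (λ z → D v + z) (∑-*ʳ c d))))
           (r-refl v) ⟩
    (D v + volume H * c) + (0ℚ + c)                   ≡⟨ collect (D v) (volume H) c ⟩
    D v + (volume H + 1ℚ) * c                         ∎
    where
    collect : ∀ D M c → (D + M * c) + (0ℚ + c) ≡ D + (M + 1ℚ) * c
    collect = solve-∀ ℚ-ring

  -- m is the degree sum of the other half, and t its degree-weighted distance
  -- to the end of the new edge there.
  ∑-weighted-total : ∀ m t → ∑ (λ x → (d x + e x) * (∑ (λ y → (d y + e y) * r x y) + (m * (r x v + 1ℚ) + t))) ≡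
    wienerSum H r + D v + D v + (m * (D v + (volume H + 1ℚ)) + (volume H + 1ℚ) * t)
  ∑-weighted-total m t = begin
    ∑ (λ x → (d x + e x) * (∑ (λ y → (d y + e y) * r x y) + (m * (r x v + 1ℚ) + t)))
      ≡⟨ ∑-cong {n} (λ x → trans (cong (λ z → (d x + e x) * (z + (m * (r x v + 1ℚ) + t))) (∑-weighted (r x)))
           (expand (d x + e x) (D x) (r x v) m t)) ⟩
    ∑ (λ x → (d x + e x) * D x + (d x + e x) * (r x v + 0ℚ) + (m * ((d x + e x) * (r x v + 1ℚ)) + (d x + e x) * t))
      ≡⟨ trans (Sumℚ.∑-distrib-+ (λ x → (d x + e x) * D x + (d x + e x) * (r x v + 0ℚ)) (λ x → m * ((d x + e x) * (r x v + 1ℚ)) + (d x + e x) * t))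
           (cong₂ _+_ (Sumℚ.∑-distrib-+ (λ x → (d x + e x) * D x) (λ x → (d x + e x) * (r x v + 0ℚ)))
             (Sumℚ.∑-distrib-+ (λ x → m * ((d x + e x) * (r x v + 1ℚ))) (λ x → (d x + e x) * t))) ⟩
    (∑ (λ x → (d x + e x) * D x) + ∑ (λ x → (d x + e x) * (r x v + 0ℚ)))
      + (∑ (λ x → m * ((d x + e x) * (r x v + 1ℚ))) + ∑ (λ x → (d x + e x) * t))
      ≡⟨ cong₂ _+_ (cong₂ _+_ (∑-weighted D) (∑-weighted-distance 0ℚ))
           (cong₂ _+_ (trans (∑-*ˡ m (λ x → (d x + e x) * (r x v + 1ℚ))) (cong (m *_) (∑-weighted-distance 1ℚ)))
             (trans (∑-weighted (λ _ → t)) (cong (_+ t) (∑-*ʳ t d)))) ⟩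
    ((wienerSum H r + D v) + (D v + (volume H + 1ℚ) * 0ℚ)) + (m * (D v + (volume H + 1ℚ) * 1ℚ) + (volume H * t + t))
      ≡⟨ collect (wienerSum H r) (D v) (volume H) m t ⟩
    wienerSum H r + D v + D v + (m * (D v + (volume H + 1ℚ)) + (volume H + 1ℚ) * t) ∎
    where
    expand : ∀ w D ρ m t → w * ((D + ρ) + (m * (ρ + 1ℚ) + t)) ≡ w * D + w * (ρ + 0ℚ) + (m * (w * (ρ + 1ℚ)) + w * t)
    expand = solve-∀ ℚ-ring
    collect : ∀ S D M m t → ((S + D) + (D + (M + 1ℚ) * 0ℚ)) + (m * (D + (M + 1ℚ) * 1ℚ) + (M * t + t)) ≡
      S + D + D + (m * (D + (M + 1ℚ)) + (M + 1ℚ) * t)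
    collect = solve-∀ ℚ-ring

-- The tree metric of the joined graph and its degree-weighted sums.

splitAt-injective : ∀ m {n} (i j : Fin (m ℕ.+ n)) → splitAt m i ≡ splitAt m j → i ≡ j
splitAt-injective m {n} i j eq =
  trans (sym (Finₚ.join-splitAt m n i)) (trans (cong (Fin.join m n) eq) (Finₚ.join-splitAt m n j))

module Join {n₁ n₂ : ℕ} (H₁ : Graph n₁) (H₂ : Graph n₂)
  (r₁ : Fin n₁ → Fin n₁ → ℚ) (r₂ : Fin n₂ → Fin n₂ → ℚ)
  (metric₁ : TreeMetric H₁ r₁) (metric₂ : TreeMetric H₂ r₂)
  (v₁ : Fin n₁) (v₂ : Fin n₂) where

  private
    module M₁ = TreeMetric metric₁
    module M₂ = TreeMetric metric₂
    module ½₁ = Half H₁ r₁ metric₁ v₁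
    module ½₂ = Half H₂ r₂ metric₂ v₂
    G = joinByEdge H₁ H₂ v₁ v₂
    V = Fin n₁ ⊎ Fin n₂

  joinDist : V → V → ℚ
  joinDist (inj₁ x) (inj₁ y) = r₁ x y
  joinDist (inj₁ x) (inj₂ y) = r₁ x v₁ + (1ℚ + r₂ v₂ y)
  joinDist (inj₂ x) (inj₁ y) = r₂ x v₂ + (1ℚ + r₁ v₁ y)
  joinDist (inj₂ x) (inj₂ y) = r₂ x y

  joinDeg : V → ℚ
  joinDeg (inj₁ x) = degℚ H₁ x + ½₁.e x
  joinDeg (inj₂ x) = degℚ H₂ x + ½₂.e x

  joinEq : V → V → Bool
  joinEq (inj₁ x) (inj₁ y) = ⌊ x ≟ y ⌋
  joinEq (inj₂ x) (inj₂ y) = ⌊ x ≟ y ⌋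
  joinEq _        _        = false

  ∑-joinAdj₁ : ∀ x (f : V → ℚ) → ∑ (λ k → 𝟙 (joinAdj H₁ H₂ v₁ v₂ (inj₁ x) (splitAt n₁ k)) * f (splitAt n₁ k)) ≡
    ∑ (λ y → 𝟙 (adj H₁ x y) * f (inj₁ y)) + ½₁.e x * f (inj₂ v₂)
  ∑-joinAdj₁ x f = trans (∑-splitAt n₁ (λ b → 𝟙 (joinAdj H₁ H₂ v₁ v₂ (inj₁ x) b) * f b))
    (cong (λ z → ∑ (λ y → 𝟙 (adj H₁ x y) * f (inj₁ y)) + z) (∑-∧≟ ⌊ x ≟ v₁ ⌋ v₂ (f ∘ inj₂)))

  ∑-joinAdj₂ : ∀ x (f : V → ℚ) → ∑ (λ k → 𝟙 (joinAdj H₁ H₂ v₁ v₂ (inj₂ x) (splitAt n₁ k)) * f (splitAt n₁ k)) ≡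
    ∑ (λ y → 𝟙 (adj H₂ x y) * f (inj₂ y)) + ½₂.e x * f (inj₁ v₁)
  ∑-joinAdj₂ x f = trans (∑-splitAt n₁ (λ b → 𝟙 (joinAdj H₁ H₂ v₁ v₂ (inj₂ x) b) * f b))
    (trans (cong (_+ ∑ (λ y → 𝟙 (adj H₂ x y) * f (inj₂ y))) (∑-∧≟′ ⌊ x ≟ v₂ ⌋ v₁ (f ∘ inj₁)))
      (ℚₚ.+-comm (½₂.e x * f (inj₁ v₁)) (∑ (λ y → 𝟙 (adj H₂ x y) * f (inj₂ y)))))

  degℚ-join : ∀ i → degℚ G i ≡ joinDeg (splitAt n₁ i)
  degℚ-join i =
    trans (degℚ-∑ G i) (trans (∑-cong {n₁ ℕ.+ n₂} λ k → sym (ℚₚ.*-identityʳ (𝟙 (adj G i k)))) (lemma (splitAt n₁ i)))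
    where
    lemma : ∀ a → ∑ (λ k → 𝟙 (joinAdj H₁ H₂ v₁ v₂ a (splitAt n₁ k)) * 1ℚ) ≡ joinDeg a
    lemma (inj₁ x) = trans (∑-joinAdj₁ x (λ _ → 1ℚ)) (cong₂ _+_
      (trans (∑-cong {n₁} λ y → ℚₚ.*-identityʳ (𝟙 (adj H₁ x y))) (sym (degℚ-∑ H₁ x))) (ℚₚ.*-identityʳ (½₁.e x)))
    lemma (inj₂ x) = trans (∑-joinAdj₂ x (λ _ → 1ℚ)) (cong₂ _+_
      (trans (∑-cong {n₂} λ y → ℚₚ.*-identityʳ (𝟙 (adj H₂ x y))) (sym (degℚ-∑ H₂ x))) (ℚₚ.*-identityʳ (½₂.e x)))

  ⌊≟⌋-join : ∀ i j → ⌊ i ≟ j ⌋ ≡ joinEq (splitAt n₁ i) (splitAt n₁ j)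
  ⌊≟⌋-join i j with i ≟ j
  ... | yes refl = sym (lemma (splitAt n₁ i))
    where
    lemma : ∀ a → joinEq a a ≡ true
    lemma (inj₁ x) = ⌊≟⌋-refl x
    lemma (inj₂ x) = ⌊≟⌋-refl x
  ... | no  i≢j  = sym (lemma (splitAt n₁ i) (splitAt n₁ j) (i≢j ∘ splitAt-injective n₁ i j))
    where
    lemma : ∀ a b → a ≢ b → joinEq a b ≡ false
    lemma (inj₁ x) (inj₁ y) a≢b = ⌊≟⌋-≢ (a≢b ∘ cong inj₁)
    lemma (inj₁ x) (inj₂ y) a≢b = refl
    lemma (inj₂ x) (inj₁ y) a≢b = refl
    lemma (inj₂ x) (inj₂ y) a≢b = ⌊≟⌋-≢ (a≢b ∘ cong inj₂)

  dist : Fin (n₁ ℕ.+ n₂) → Fin (n₁ ℕ.+ n₂) → ℚ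
  dist i j = joinDist (splitAt n₁ i) (splitAt n₁ j)

  private
    0≤1 : 0ℚ ≤ 1ℚ
    0≤1 = 0≤𝟙 true

    distance-sym : ∀ {p q p′ q′} → p ≡ p′ → q ≡ q′ → p + (1ℚ + q) ≡ q′ + (1ℚ + p′)
    distance-sym {p} {q} refl refl = lemma p q
      where
      lemma : ∀ p q → p + (1ℚ + q) ≡ q + (1ℚ + p)
      lemma = solve-∀ ℚ-ring

    triangle-detour : ∀ xz xv vz s t → xz ≤ xv + vz → 0ℚ ≤ s → 0ℚ ≤ t → xz ≤ (xv + (1ℚ + s)) + (t + (1ℚ + vz))
    triangle-detour xz xv vz s t p 0≤s 0≤t = 0≤q-p⇒p≤q (subst (0ℚ ≤_) (sym (expand xz xv vz s t))
      (0≤p+q (p≤q⇒0≤q-p p) (0≤p+q (0≤p+q 0≤1 0≤1) (0≤p+q 0≤s 0≤t))))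
      where
      expand : ∀ xz xv vz s t → (xv + (1ℚ + s)) + (t + (1ℚ + vz)) - xz ≡ (xv + vz - xz) + ((1ℚ + 1ℚ) + (s + t))
      expand = solve-∀ ℚ-ring

    triangle-late : ∀ xv xy yv s → xv ≤ xy + yv → xv + (1ℚ + s) ≤ xy + (yv + (1ℚ + s))
    triangle-late xv xy yv s p = subst (xv + (1ℚ + s) ≤_) (ℚₚ.+-assoc xy yv (1ℚ + s)) (ℚₚ.+-monoˡ-≤ (1ℚ + s) p)

    triangle-early : ∀ xv vy yz vz → vz ≤ vy + yz → xv + (1ℚ + vz) ≤ (xv + (1ℚ + vy)) + yz
    triangle-early xv vy yz vz p = subst (xv + (1ℚ + vz) ≤_) (lemma xv vy yz)
      (ℚₚ.+-monoʳ-≤ xv (ℚₚ.+-monoʳ-≤ 1ℚ p))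
      where
      lemma : ∀ a b c → a + (1ℚ + (b + c)) ≡ (a + (1ℚ + b)) + c
      lemma = solve-∀ ℚ-ring

  joinDist-nonneg : ∀ a b → 0ℚ ≤ joinDist a b
  joinDist-nonneg (inj₁ x) (inj₁ y) = M₁.0≤r x y
  joinDist-nonneg (inj₁ x) (inj₂ y) = 0≤p+q (M₁.0≤r x v₁) (0≤p+q 0≤1 (M₂.0≤r v₂ y))
  joinDist-nonneg (inj₂ x) (inj₁ y) = 0≤p+q (M₂.0≤r x v₂) (0≤p+q 0≤1 (M₁.0≤r v₁ y))
  joinDist-nonneg (inj₂ x) (inj₂ y) = M₂.0≤r x y

  joinDist-refl : ∀ a → joinDist a a ≡ 0ℚ
  joinDist-refl (inj₁ x) = M₁.r-refl x
  joinDist-refl (inj₂ x) = M₂.r-refl x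

  joinDist-sym : ∀ a b → joinDist a b ≡ joinDist b a
  joinDist-sym (inj₁ x) (inj₁ y) = M₁.r-sym x y
  joinDist-sym (inj₁ x) (inj₂ y) = distance-sym (M₁.r-sym x v₁) (M₂.r-sym v₂ y)
  joinDist-sym (inj₂ x) (inj₁ y) = distance-sym (M₂.r-sym x v₂) (M₁.r-sym v₁ y)
  joinDist-sym (inj₂ x) (inj₂ y) = M₂.r-sym x y

  -- If only the middle point lies in the other half, the detour crosses the new edge twice. If the
  -- ends lie in different halves, the inequality is needed only in the half of the middle point,
  -- with the end of the new edge as one of the three points.
  joinDist-triangle : ∀ a b c → joinDist a c ≤ joinDist a b + joinDist b c
  joinDist-triangle (inj₁ x) (inj₁ y) (inj₁ z) = M₁.r-triangle x y z
  joinDist-triangle (inj₁ x) (inj₁ y) (inj₂ z) =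
    triangle-late (r₁ x v₁) (r₁ x y) (r₁ y v₁) (r₂ v₂ z) (M₁.r-triangle x y v₁)
  joinDist-triangle (inj₁ x) (inj₂ y) (inj₁ z) =
    triangle-detour (r₁ x z) (r₁ x v₁) (r₁ v₁ z) (r₂ v₂ y) (r₂ y v₂) (M₁.r-triangle x v₁ z) (M₂.0≤r v₂ y) (M₂.0≤r y v₂)
  joinDist-triangle (inj₁ x) (inj₂ y) (inj₂ z) =
    triangle-early (r₁ x v₁) (r₂ v₂ y) (r₂ y z) (r₂ v₂ z) (M₂.r-triangle v₂ y z)
  joinDist-triangle (inj₂ x) (inj₁ y) (inj₁ z) =
    triangle-early (r₂ x v₂) (r₁ v₁ y) (r₁ y z) (r₁ v₁ z) (M₁.r-triangle v₁ y z)
  joinDist-triangle (inj₂ x) (inj₁ y) (inj₂ z) =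
    triangle-detour (r₂ x z) (r₂ x v₂) (r₂ v₂ z) (r₁ v₁ y) (r₁ y v₁) (M₂.r-triangle x v₂ z) (M₁.0≤r v₁ y) (M₁.0≤r y v₁)
  joinDist-triangle (inj₂ x) (inj₂ y) (inj₁ z) =
    triangle-late (r₂ x v₂) (r₂ x y) (r₂ y v₂) (r₁ v₁ z) (M₂.r-triangle x y v₂)
  joinDist-triangle (inj₂ x) (inj₂ y) (inj₂ z) = M₂.r-triangle x y z

  joinDist-neighbours : ∀ a b → ∑ (λ k → 𝟙 (joinAdj H₁ H₂ v₁ v₂ a (splitAt n₁ k)) * joinDist (splitAt n₁ k) b) ≡
    joinDeg a * (joinDist a b + 1ℚ) + (𝟙 (joinEq a b) + 𝟙 (joinEq a b)) - (1ℚ + 1ℚ)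
  joinDist-neighbours (inj₁ x) (inj₁ y) = trans (∑-joinAdj₁ x (λ c → joinDist c (inj₁ y)))
    (trans (cong (λ z → ∑ (λ k → 𝟙 (adj H₁ x k) * r₁ k y) + ½₁.e x * z)
        (trans (cong (_+ (1ℚ + r₁ v₁ y)) (M₂.r-refl v₂)) (ℚₚ.+-identityˡ (1ℚ + r₁ v₁ y))))
      (½₁.∑-neighbours-inside x y))
  joinDist-neighbours (inj₁ x) (inj₂ y) = trans (∑-joinAdj₁ x (λ c → joinDist c (inj₂ y)))
    (½₁.∑-neighbours-across x (r₂ v₂ y))
  joinDist-neighbours (inj₂ x) (inj₁ y) = trans (∑-joinAdj₂ x (λ c → joinDist c (inj₁ y)))
    (½₂.∑-neighbours-across x (r₁ v₁ y))
  joinDist-neighbours (inj₂ x) (inj₂ y) = trans (∑-joinAdj₂ x (λ c → joinDist c (inj₂ y)))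
    (trans (cong (λ z → ∑ (λ k → 𝟙 (adj H₂ x k) * r₂ k y) + ½₂.e x * z)
        (trans (cong (_+ (1ℚ + r₂ v₂ y)) (M₁.r-refl v₁)) (ℚₚ.+-identityˡ (1ℚ + r₂ v₂ y))))
      (½₂.∑-neighbours-inside x y))

  joinMetric : TreeMetric G dist
  joinMetric = record
    { 0≤r          = λ i j → joinDist-nonneg (splitAt n₁ i) (splitAt n₁ j)
    ; r-refl       = λ i → joinDist-refl (splitAt n₁ i)
    ; r-sym        = λ i j → joinDist-sym (splitAt n₁ i) (splitAt n₁ j)
    ; r-triangle   = λ i j k → joinDist-triangle (splitAt n₁ i) (splitAt n₁ j) (splitAt n₁ k)
    ; ∑-neighbours = λ i j → trans (joinDist-neighbours (splitAt n₁ i) (splitAt n₁ j))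
        (cong₂ (λ d b → d * (dist i j + 1ℚ) + (𝟙 b + 𝟙 b) - (1ℚ + 1ℚ)) (sym (degℚ-join i)) (sym (⌊≟⌋-join i j)))
    }

  private
    M₁ M₂ D₁ D₂ : ℚ
    M₁ = volume H₁
    M₂ = volume H₂
    D₁ = weightedDistance H₁ r₁ v₁
    D₂ = weightedDistance H₂ r₂ v₂

  volume-join : volume G ≡ (M₁ + 1ℚ) + (M₂ + 1ℚ)
  volume-join = begin
    volume G                                   ≡⟨ ∑-cong {n₁ ℕ.+ n₂} degℚ-join ⟩
    ∑ (joinDeg ∘ splitAt n₁)                   ≡⟨ ∑-splitAt n₁ joinDeg ⟩
    ∑ (joinDeg ∘ inj₁) + ∑ (joinDeg ∘ inj₂)    ≡⟨ cong₂ _+_ (half H₁ v₁) (half H₂ v₂) ⟩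
    (M₁ + 1ℚ) + (M₂ + 1ℚ)                      ∎
    where
    half : ∀ {n} (H : Graph n) v → ∑ (λ x → degℚ H x + 𝟙 ⌊ x ≟ v ⌋) ≡ volume H + 1ℚ
    half {n} H v = trans (Sumℚ.∑-distrib-+ (degℚ H) (λ x → 𝟙 ⌊ x ≟ v ⌋)) (cong (λ z → volume H + z)
      (trans (∑-cong {n} λ x → sym (ℚₚ.*-identityʳ (𝟙 ⌊ x ≟ v ⌋))) (∑-𝟙≟ v (λ _ → 1ℚ))))

  wienerSum-join : wienerSum G dist ≡
    (wienerSum H₁ r₁ + D₁ + D₁ + ((M₂ + 1ℚ) * (D₁ + (M₁ + 1ℚ)) + (M₁ + 1ℚ) * D₂)) +
    (wienerSum H₂ r₂ + D₂ + D₂ + ((M₁ + 1ℚ) * (D₂ + (M₂ + 1ℚ)) + (M₂ + 1ℚ) * D₁))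
  wienerSum-join = begin
    wienerSum G dist
      ≡⟨ ∑-cong {n₁ ℕ.+ n₂} (λ i → cong₂ _*_ (degℚ-join i) (trans
           (∑-cong {n₁ ℕ.+ n₂} λ j → cong (_* dist i j) (degℚ-join j))
           (∑-splitAt n₁ (λ b → joinDeg b * joinDist (splitAt n₁ i) b)))) ⟩
    ∑ (total ∘ splitAt n₁)
      ≡⟨ ∑-splitAt n₁ total ⟩
    ∑ (total ∘ inj₁) + ∑ (total ∘ inj₂)
      ≡⟨ cong₂ _+_
           (trans (∑-cong {n₁} λ x → cong (λ z → joinDeg (inj₁ x) * (∑ (λ y → joinDeg (inj₁ y) * r₁ x y) + z))
             (trans (∑-cong {n₂} λ y → cong (joinDeg (inj₂ y) *_) (trans (cong (λ z → r₁ x v₁ + (1ℚ + z)) (M₂.r-sym v₂ y)) (rearrange (r₁ x v₁) (r₂ y v₂))))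
               (trans (½₂.∑-weighted-distance (r₁ x v₁ + 1ℚ)) (ℚₚ.+-comm D₂ _))))
             (½₁.∑-weighted-total (M₂ + 1ℚ) D₂))
           (trans (∑-cong {n₂} λ x → cong (joinDeg (inj₂ x) *_) (trans (ℚₚ.+-comm (∑ (λ y → joinDeg (inj₁ y) * (r₂ x v₂ + (1ℚ + r₁ v₁ y)))) _)
             (cong (λ z → ∑ (λ y → joinDeg (inj₂ y) * r₂ x y) + z)
               (trans (∑-cong {n₁} λ y → cong (joinDeg (inj₁ y) *_) (trans (cong (λ z → r₂ x v₂ + (1ℚ + z)) (M₁.r-sym v₁ y)) (rearrange (r₂ x v₂) (r₁ y v₁))))
                 (trans (½₁.∑-weighted-distance (r₂ x v₂ + 1ℚ)) (ℚₚ.+-comm D₁ _))))))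
             (½₂.∑-weighted-total (M₁ + 1ℚ) D₁)) ⟩
    (wienerSum H₁ r₁ + D₁ + D₁ + ((M₂ + 1ℚ) * (D₁ + (M₁ + 1ℚ)) + (M₁ + 1ℚ) * D₂)) +
    (wienerSum H₂ r₂ + D₂ + D₂ + ((M₁ + 1ℚ) * (D₂ + (M₂ + 1ℚ)) + (M₂ + 1ℚ) * D₁)) ∎
    where
    total : V → ℚ
    total a =
      joinDeg a * (∑ (λ y → joinDeg (inj₁ y) * joinDist a (inj₁ y)) + ∑ (λ y → joinDeg (inj₂ y) * joinDist a (inj₂ y)))
    rearrange : ∀ a b → a + (1ℚ + b) ≡ b + (a + 1ℚ)
    rearrange = solve-∀ ℚ-ring

-- The joined trees

module _ {A B : Set} (f : A → ℕ) (g : B → ℕ) {c β γ} (0<c : 0ℚ < c) (0<β : 0ℚ < β) (0<γ : 0ℚ < γ) (α : ℚ) where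

  affine : A → B → ℚ
  affine a b = c * (α + β * ι (f a) + γ * ι (g b))

  -- Varying one argument at a time cancels the contribution of the other, and the positive
  -- coefficients can be divided out.
  affine-minimal⇔ : ∀ a b → (∀ a′ b′ → affine a b ≤ affine a′ b′) ⇔
    ((∀ a′ → f a ℕ.≤ f a′) × (∀ b′ → g b ℕ.≤ g b′))
  affine-minimal⇔ a b = mk⇔
    (λ minimal →
      (λ a′ → ι-cancel-≤ (*-cancelˡ-≤ 0<β (0≤q-p⇒p≤q (subst (0ℚ ≤_)
        (cancel-γ α (β * ι (f a)) (β * ι (f a′)) (γ * ι (g b)))
        (p≤q⇒0≤q-p (*-cancelˡ-≤ 0<c (minimal a′ b))))))) ,
      (λ b′ → ι-cancel-≤ (*-cancelˡ-≤ 0<γ (0≤q-p⇒p≤q (subst (0ℚ ≤_)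
        (cancel-β α (β * ι (f a)) (γ * ι (g b)) (γ * ι (g b′)))
        (p≤q⇒0≤q-p (*-cancelˡ-≤ 0<c (minimal a b′))))))))
    (λ (minimal-f , minimal-g) a′ b′ → *-monoˡ-≤ (ℚₚ.<⇒≤ 0<c) (ℚₚ.+-mono-≤
      (ℚₚ.+-monoʳ-≤ α (*-monoˡ-≤ (ℚₚ.<⇒≤ 0<β) (ι-mono-≤ (minimal-f a′))))
      (*-monoˡ-≤ (ℚₚ.<⇒≤ 0<γ) (ι-mono-≤ (minimal-g b′)))))
    where
    cancel-γ : ∀ α x x′ y → (α + x′ + y) - (α + x + y) ≡ x′ - x
    cancel-γ = solve-∀ ℚ-ring
    cancel-β : ∀ α x y y′ → (α + x + y′) - (α + x + y) ≡ y′ - y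
    cancel-β = solve-∀ ℚ-ring

module JoinedTrees {n₁ n₂ : ℕ} (T₁ : Graph n₁) (T₂ : Graph n₂) (tree₁ : IsTree T₁) (tree₂ : IsTree T₂) where

  private
    module W₁ = TreeWalks T₁ tree₁
    module W₂ = TreeWalks T₂ tree₂
    module J v₁ v₂ = Join T₁ T₂ W₁.distℚ W₂.distℚ W₁.treeMetric W₂.treeMetric v₁ v₂
    M₁ M₂ S₁ S₂ four : ℚ
    M₁ = volume T₁
    M₂ = volume T₂
    S₁ = wienerSum T₁ W₁.distℚ
    S₂ = wienerSum T₂ W₂.distℚ
    four = 1ℚ + 1ℚ + (1ℚ + 1ℚ)
    G : Fin n₁ → Fin n₂ → Graph (n₁ ℕ.+ n₂)
    G = joinByEdge T₁ T₂

  -- The successor counts the new edge; in this form the number is visibly nonzero and independent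
  -- of where the edge is attached.
  twiceEdges : ℕ
  twiceEdges = 2 ℕ.* suc (edgeCount T₁ ℕ.+ edgeCount T₂)

  -- Degree sums split along the two halves more easily than the ordered edge count, so the
  -- handshake identity is used on all three graphs.
  2*edgeCount-join : ∀ v₁ v₂ → 2 ℕ.* edgeCount (G v₁ v₂) ≡ twiceEdges
  2*edgeCount-join v₁ v₂ = ι-injective (begin
    ι (2 ℕ.* edgeCount (G v₁ v₂))                               ≡⟨ handshake (G v₁ v₂) ⟩
    volume (G v₁ v₂)                                            ≡⟨ J.volume-join v₁ v₂ ⟩
    (M₁ + 1ℚ) + (M₂ + 1ℚ)
      ≡⟨ cong₂ (λ x y → (x + 1ℚ) + (y + 1ℚ)) (handshake T₁) (handshake T₂) ⟨
    (ι (2 ℕ.* edgeCount T₁) + 1ℚ) + (ι (2 ℕ.* edgeCount T₂) + 1ℚ)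
      ≡⟨ cong₂ _+_ (ι-+1 (2 ℕ.* edgeCount T₁)) (ι-+1 (2 ℕ.* edgeCount T₂)) ⟩
    ι (suc (2 ℕ.* edgeCount T₁)) + ι (suc (2 ℕ.* edgeCount T₂)) ≡⟨ ι-+ (suc (2 ℕ.* edgeCount T₁)) _ ⟨
    ι (suc (2 ℕ.* edgeCount T₁) ℕ.+ suc (2 ℕ.* edgeCount T₂))
      ≡⟨ cong ι (double (edgeCount T₁) (edgeCount T₂)) ⟩
    ι twiceEdges                                                ∎)
    where
    ι-+1 : ∀ n → ι n + 1ℚ ≡ ι (suc n)
    ι-+1 n = trans (ℚₚ.+-comm (ι n) 1ℚ) (sym (ι-suc n))
    double : ∀ a b → suc (2 ℕ.* a) ℕ.+ suc (2 ℕ.* b) ≡ 2 ℕ.* suc (a ℕ.+ b)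
    double = ℕ-solve-∀

  private
    -- In `wienerSum-join` the coefficient of `D₁` is 2 (M₂ + 2), and 2 D₁ = 4 W₁ - M₁ by
    -- `weightedDistance-transmission`. This gives `β`, and symmetrically `γ`, and leaves -(M₂ + 2)
    -- M₁ in `α`. The summand 2 keeps `β` and `γ` positive even for one-vertex trees.
    c β γ α : ℚ
    c = ratio 1 twiceEdges * ½
    β = (M₂ + (1ℚ + 1ℚ)) * four
    γ = (M₁ + (1ℚ + 1ℚ)) * four
    α = S₁ + S₂ + ((M₁ + 1ℚ) * (M₂ + 1ℚ) + (M₁ + 1ℚ) * (M₂ + 1ℚ))
      - (M₂ + (1ℚ + 1ℚ)) * M₁ - (M₁ + (1ℚ + 1ℚ)) * M₂

    0<c : 0ℚ < c
    0<c = 0<p*q {ratio 1 twiceEdges} (0<ratio 0 (ℕ.pred twiceEdges)) (0<ratio 0 1)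

    0<four : 0ℚ < four
    0<four = 0<p+q (ℚₚ.<⇒≤ (0<p+q (ℚₚ.<⇒≤ 0<1) 0<1)) (0<p+q (ℚₚ.<⇒≤ 0<1) 0<1)

    0<volume+2 : ∀ {n} (H : Graph n) → 0ℚ < volume H + (1ℚ + 1ℚ)
    0<volume+2 H = 0<p+q (0≤∑ λ i → 0≤ι (deg H i)) (0<p+q (ℚₚ.<⇒≤ 0<1) 0<1)

    0<β : 0ℚ < β
    0<β = 0<p*q (0<volume+2 T₂) 0<four

    0<γ : 0ℚ < γ
    0<γ = 0<p*q (0<volume+2 T₁) 0<four

  κ : Fin n₁ → Fin n₂ → ℚ
  κ = affine W₁.transmission W₂.transmission 0<c 0<β 0<γ α

  wienerSum-affine : ∀ v₁ v₂ → wienerSum (G v₁ v₂) (J.dist v₁ v₂) ≡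
    α + β * ι (W₁.transmission v₁) + γ * ι (W₂.transmission v₂)
  wienerSum-affine v₁ v₂ = begin
    wienerSum (G v₁ v₂) (J.dist v₁ v₂)     ≡⟨ J.wienerSum-join v₁ v₂ ⟩
    (S₁ + D₁ + D₁ + ((M₂ + 1ℚ) * (D₁ + (M₁ + 1ℚ)) + (M₁ + 1ℚ) * D₂)) +
    (S₂ + D₂ + D₂ + ((M₁ + 1ℚ) * (D₂ + (M₂ + 1ℚ)) + (M₂ + 1ℚ) * D₁))
      ≡⟨ collect S₁ S₂ D₁ D₂ M₁ M₂ ⟩
    α + (M₂ + (1ℚ + 1ℚ)) * (D₁ + D₁ + M₁) + (M₁ + (1ℚ + 1ℚ)) * (D₂ + D₂ + M₂)
      ≡⟨ cong₂ (λ x y → α + (M₂ + (1ℚ + 1ℚ)) * x + (M₁ + (1ℚ + 1ℚ)) * y)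
           (W₁.weightedDistance-transmission v₁) (W₂.weightedDistance-transmission v₂) ⟩
    α + (M₂ + (1ℚ + 1ℚ)) * (four * ι (W₁.transmission v₁)) + (M₁ + (1ℚ + 1ℚ)) * (four * ι (W₂.transmission v₂))
      ≡⟨ cong₂ (λ x y → α + x + y) (ℚₚ.*-assoc (M₂ + (1ℚ + 1ℚ)) four _) (ℚₚ.*-assoc (M₁ + (1ℚ + 1ℚ)) four _) ⟨
    α + β * ι (W₁.transmission v₁) + γ * ι (W₂.transmission v₂) ∎
    where
    D₁ = weightedDistance T₁ W₁.distℚ v₁
    D₂ = weightedDistance T₂ W₂.distℚ v₂
    collect : ∀ S₁ S₂ D₁ D₂ M₁ M₂ →
      (S₁ + D₁ + D₁ + ((M₂ + 1ℚ) * (D₁ + (M₁ + 1ℚ)) + (M₁ + 1ℚ) * D₂)) +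
      (S₂ + D₂ + D₂ + ((M₁ + 1ℚ) * (D₂ + (M₂ + 1ℚ)) + (M₂ + 1ℚ) * D₁)) ≡
      (S₁ + S₂ + ((M₁ + 1ℚ) * (M₂ + 1ℚ) + (M₁ + 1ℚ) * (M₂ + 1ℚ))
        - (M₂ + (1ℚ + 1ℚ)) * M₁ - (M₁ + (1ℚ + 1ℚ)) * M₂)
      + (M₂ + (1ℚ + 1ℚ)) * (D₁ + D₁ + M₁) + (M₁ + (1ℚ + 1ℚ)) * (D₂ + D₂ + M₂)
    collect = solve-∀ ℚ-ring

  κ-isKemenyConstant : ∀ v₁ v₂ → IsKemenyConstant (G v₁ v₂) (κ v₁ v₂)
  κ-isKemenyConstant v₁ v₂ = subst (IsKemenyConstant (G v₁ v₂))
    (cong₂ (λ m s → ratio 1 m * ½ * s) (2*edgeCount-join v₁ v₂) (wienerSum-affine v₁ v₂))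
    (Kemeny.isKemenyConstant (G v₁ v₂) (J.dist v₁ v₂) (J.joinMetric v₁ v₂)
      (λ 2m≡0 → ℕₚ.1+n≢0 (trans (sym (2*edgeCount-join v₁ v₂)) 2m≡0)))

  κ-minimal⇔centroids : ∀ v₁ v₂ → (∀ w₁ w₂ → κ v₁ v₂ ≤ κ w₁ w₂) ⇔ (IsCentroid T₁ v₁ × IsCentroid T₂ v₂)
  κ-minimal⇔centroids v₁ v₂ = mk⇔
    (λ minimal → let minimal₁ , minimal₂ = Equivalence.to minimal⇔ minimal in
      Equivalence.from centroid₁ minimal₁ , Equivalence.from centroid₂ minimal₂)
    (λ (c₁ , c₂) → Equivalence.from minimal⇔ (Equivalence.to centroid₁ c₁ , Equivalence.to centroid₂ c₂))
    where
    minimal⇔ = affine-minimal⇔ W₁.transmission W₂.transmission 0<c 0<β 0<γ α v₁ v₂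
    centroid₁ = Centroids.centroid⇔minimal T₁ tree₁ v₁
    centroid₂ = Centroids.centroid⇔minimal T₂ tree₂ v₂

corollary2p8 : ∀ {n₁ n₂ : ℕ} (T₁ : Graph n₁) (T₂ : Graph n₂) → IsTree T₁ → IsTree T₂ →
    ∃ λ (κ : Fin n₁ → Fin n₂ → ℚ) →
    (∀ v₁ v₂ → IsKemenyConstant (joinByEdge T₁ T₂ v₁ v₂) (κ v₁ v₂))
    × (∀ v₁ v₂ → (∀ w₁ w₂ → κ v₁ v₂ ≤ κ w₁ w₂) ⇔ (IsCentroid T₁ v₁ × IsCentroid T₂ v₂))
corollary2p8 T₁ T₂ tree₁ tree₂ = κ , κ-isKemenyConstant , κ-minimal⇔centroids
  where open JoinedTrees T₁ T₂ tree₁ tree₂
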